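{- For every integer $k\ge 4$ there is a family $\{F_n\}_{n=1}^{\infty}$ of unsatisfiable $k$-CNF formulas of size $\Theta(n)$ that can be refuted in resolution in length $L(F_n\vdash 0)=O(n)$ and width $W(F_n\vdash 0)=O(1)$ but require clause space $\mathit{Sp}(F_n\vdash 0)=\Theta(\sqrt{n})$.
   Context: A literal is a propositional variable $x$ or its negation $\overline{x}$. A clause is a finite set (disjunction) of literals over pairwise distinct variables; $0$ denotes the empty clause. A CNF formula is a finite set of clauses; it is a $k$-CNF formula if every clause has at most $k$ literals. The size of a CNF formula is the total number of literals in it, counted with repetitions. The resolution rule derives $B\vee C$ from $B\vee x$ and $C\vee\overline{x}$. A resolution derivation from a CNF formula $F$ is a sequence $\{\mathbb{C}_0,\dots,\mathbb{C}_\tau\}$ of sets of clauses with $\mathbb{C}_0=\emptyset$ such that each $\mathbb{C}_t$ is obtained from $\mathbb{C}_{t-1}$ by one of: axiom download (adding some $C\in F$), erasure (removing some clause of $\mathbb{C}_{t-1}$), inference (adding a clause derived by the resolution rule from two clauses in $\mathbb{C}_{t-1}$). A refutation of $F$ is a derivation with $\mathbb{C}_\tau=\{0\}$. The length of a derivation is the number of distinct clauses in it, its width is the maximal number of literals in any clause in it, and its clause space is $\max_t|\mathbb{C}_t|$. $L(F\vdash 0)$, $W(F\vdash 0)$ and $\mathit{Sp}(F\vdash 0)$ denote the minimum length, width and clause space, respectively, taken (separately) over all refutations of $F$. -}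

module Defs where

open import Data.Bool.Base using (Bool; true; false)
import Data.Bool.Properties as Bool
open import Data.Fin.Base using (Fin)
open import Data.List.Base
  using (List; []; _∷_; [_]; map; sum; length; filter; concat; deduplicate)
open import Data.List.Extrema.Nat using (max)
open import Data.List.Membership.Propositional using (_∈_)
open import Data.List.Relation.Binary.BagAndSetEquality using (_∼[_]_; set)
open import Data.List.Relation.Unary.All using (All)
open import Data.Maybe.Base using (Maybe; just; nothing; is-just)
import Data.Maybe.Properties as Maybe
open import Data.Nat.Base using (ℕ; _*_; _^_; _≤_; _≥_)
open import Data.Product.Base using (∃-syntax; _×_; _,_)
open import Data.Sum.Base using (_⊎_)
open import Data.Vec.Base using (Vec; lookup; replicate; countᵇ; _[_]≔_)
import Data.Vec.Properties as Vec
open import Function.Bundles using (_⇔_)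
open import Relation.Binary.Construct.Closure.ReflexiveTransitive
  using (Star; ε; _◅_)
open import Relation.Binary.Definitions using (DecidableEquality)
open import Relation.Binary.PropositionalEquality.Core using (_≡_)
open import Relation.Nullary.Decidable.Core using (¬?)
open import Relation.Nullary.Negation.Core using (¬_)

-- (x , true) is the literal x, and (x , false) is its negation.
Literal : ℕ → Set
Literal v = Fin v × Bool

-- A clause is a finite set of literals over pairwise distinct variables, so
-- it amounts to saying for each variable whether it is absent (nothing),
-- occurs positively (just true) or occurs negatively (just false).
Clause : ℕ → Set
Clause v = Vec (Maybe Bool) v

infix 4 _∈ᶜ_ _≟_

_∈ᶜ_ : ∀ {v} → Literal v → Clause v → Set
(x , b) ∈ᶜ C = lookup C x ≡ just b

_≟_ : ∀ {v} → DecidableEquality (Clause v)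
_≟_ = Vec.≡-dec (Maybe.≡-dec Bool._≟_)

𝟘 : ∀ {v} → Clause v
𝟘 = replicate _ nothing

∣_∣ᶜ : ∀ {v} → Clause v → ℕ
∣ C ∣ᶜ = countᵇ is-just C

-- Finite sets of clauses are lists in which order and repetitions are
-- irrelevant; everything below depends only on the underlying set.
ClauseSet : ℕ → Set
ClauseSet v = List (Clause v)

elements : ∀ {v} → ClauseSet v → List (Clause v)
elements = deduplicate _≟_

card : ∀ {v} → ClauseSet v → ℕ
card ℂ = length (elements ℂ)

CNF : ℕ → Set
CNF = ClauseSet

IsCNF[_] : ∀ {v} → ℕ → CNF v → Set
IsCNF[ k ] F = All (λ C → ∣ C ∣ᶜ ≤ k) F

size : ∀ {v} → CNF v → ℕ
size F = sum (map ∣_∣ᶜ (elements F))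

_⊨_ : ∀ {v} → (Fin v → Bool) → Clause v → Set
α ⊨ C = ∃[ x ] (x , α x) ∈ᶜ C

Unsatisfiable : ∀ {v} → CNF v → Set
Unsatisfiable F = ¬ (∃[ α ] All (α ⊨_) F)

-- R = B ∨ C as sets of literals.  As R is a clause, this fails if B and C
-- contain opposite literals.
IsDisjunction : ∀ {v} → Clause v → Clause v → Clause v → Set
IsDisjunction B C R = ∀ ℓ → ℓ ∈ᶜ R ⇔ (ℓ ∈ᶜ B ⊎ ℓ ∈ᶜ C)

-- P = B ∨ x and Q = C ∨ ¬ x, where the variable x occurs in neither B nor C.
record IsResolvent {v} (P Q R : Clause v) : Set where
  field
    x       : Fin v
    B C     : Clause v
    x∉B     : lookup B x ≡ nothing
    x∉C     : lookup C x ≡ nothing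
    P≡B∨x   : P ≡ B [ x ]≔ just true
    Q≡C∨¬x  : Q ≡ C [ x ]≔ just false
    R≡B∨C   : IsDisjunction B C R

data Step {v} (F : CNF v) : ClauseSet v → ClauseSet v → Set where
  download  : ∀ {ℂ C} → C ∈ F → Step F ℂ (C ∷ ℂ)
  erase     : ∀ {ℂ C} → C ∈ ℂ → Step F ℂ (filter (λ D → ¬? (D ≟ C)) ℂ)
  infer     : ∀ {ℂ P Q R} → P ∈ ℂ → Q ∈ ℂ → IsResolvent P Q R →
              Step F ℂ (R ∷ ℂ)

record Refutation {v} (F : CNF v) : Set where
  field
    final      : ClauseSet v
    derivation : Star (Step F) [] final
    final≡[𝟘]  : final ∼[ set ] [ 𝟘 ]

configurations : ∀ {v} {F : CNF v} {ℂ 𝔻} → Star (Step F) ℂ 𝔻 →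
                 List (ClauseSet v)
configurations {ℂ = ℂ} ε       = [ ℂ ]
configurations {ℂ = ℂ} (_ ◅ π) = ℂ ∷ configurations π

module _ {v} {F : CNF v} (π : Refutation F) where
  open Refutation π

  refLength : ℕ
  refLength = card (concat (configurations derivation))

  refWidth : ℕ
  refWidth = max 0 (map ∣_∣ᶜ (concat (configurations derivation)))

  refSpace : ℕ
  refSpace = max 0 (map card (configurations derivation))

_IsMinimumOf_ : {A : Set} → ℕ → (A → ℕ) → Set
m IsMinimumOf f = (∃[ a ] f a ≡ m) × (∀ a → m ≤ f a)

L[_⊢0]≡_ W[_⊢0]≡_ Sp[_⊢0]≡_ : ∀ {v} → CNF v → ℕ → Set
L[  F ⊢0]≡ m = m IsMinimumOf refLength {F = F}
W[  F ⊢0]≡ m = m IsMinimumOf refWidth  {F = F}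
Sp[ F ⊢0]≡ m = m IsMinimumOf refSpace  {F = F}

-- Bounds may fail for finitely many n.  Constants can be rounded up to natural
-- numbers, also for lower bounds as these are stated as g = O(f).
infix 4 _∈O_ _∈Θ_ _∈Θ√_

_∈O_ : (ℕ → ℕ) → (ℕ → ℕ) → Set
f ∈O g = ∃[ c ] ∃[ N ] (∀ n → n ≥ N → f n ≤ c * g n)

_∈Θ_ : (ℕ → ℕ) → (ℕ → ℕ) → Set
f ∈Θ g = f ∈O g × g ∈O f

-- f = Θ(√g): the inequalities f n ≤ c √(g n) and √(g n) ≤ d (f n), squared
-- to avoid real square roots.
_∈Θ√_ : (ℕ → ℕ) → (ℕ → ℕ) → Set
f ∈Θ√ g =
  (∃[ c ] ∃[ N ] (∀ n → n ≥ N → f n ^ 2 ≤ c ^ 2 * g n)) ×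
  (∃[ d ] ∃[ N ] (∀ n → n ≥ N → g n ≤ (d * f n) ^ 2))

{-# OPTIONS --safe #-}

-- F n is a pebbling formula on a grid of height H ≈ √n, (suc j , i) having the
-- predecessors (j , i) and (j , suc i), in which the truth of a vertex is the
-- exclusive or of two variables.  Two further variables per vertex split the
-- axioms into clauses of width 4.  Refuting the triangle below the sink row by
-- row takes length O(n), width 4 and space O(√n).
--
-- For the lower bound, follow a refutation in space s and keep a set U of
-- vertices such that every truth assignment to the vertices that respects the
-- inner axioms and the sink and makes U true extends to the variables so as to
-- satisfy the current configuration; only the download of a source enlarges U.
-- As in Klawe's bound on black-white pebblings, U stays low: at most (K - j) / 3
-- of its vertices are at level j or above, where K = 18 s + 3, so that U never
-- cuts off a sink at a level H ≥ K.  To bound |U| by 6 s before each source,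
-- Hall's argument yields a set X of at most s vertices such that each clause
-- mentioning a vertex outside X has such a vertex of its own, where a suitable
-- literal satisfies the clause without restricting the value of the vertex.
-- Hence only X and its predecessors X⁺ matter.  A set Y can cut off vertices on
-- at most |Y| consecutive levels beyond its own, so U splits into segments of
-- levels between levels not cut off at all by U and X⁺, and in a segment where U
-- has more than twice as many vertices as X⁺ it may be replaced by X⁺.
--
-- The minima are found by search: clause sets up to equality form a finite
-- graph, in which reachability is decidable.

module Submission where

open import Defs
open import Data.Bool.Base using (Bool; true; false; not; _∧_; _∨_; _xor_)
import Data.Bool.Base as Bool using (T)
import Data.Bool.Properties as Bool
open import Data.Empty using (⊥-elim)
open import Data.Fin.Base using (Fin; zero; suc; toℕ; combine; remQuot)
open import Data.Fin.Patterns
import Data.Fin.Properties as Fin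
open import Data.List.Base
  using (List; []; _∷_; [_]; _++_; map; filter; length; concat; concatMap;
    cartesianProductWith; cartesianProduct; upTo; deduplicate; foldr; allFin)
open import Data.List.Extrema.Nat using (max; max≤v⁺; xs≤max)
open import Data.List.Membership.Propositional using (_∈_; _∉_; lose; find)
open import Data.List.Membership.Propositional.Properties
open import Data.List.Properties
  using (filter-notAll; length-++; length-map; map-++; ++-identityʳ; length-upTo;
    length-deduplicate)
open import Data.List.Relation.Binary.Subset.Propositional using (_⊆_)
open import Data.List.Relation.Binary.Subset.Propositional.Properties using (∷⁺ʳ; filter-⊆)
open import Data.List.Relation.Unary.All as All using (All; []; _∷_)
import Data.List.Relation.Unary.All.Properties as All
open import Data.List.Relation.Unary.AllPairs using ([]; _∷_)
open import Data.List.Relation.Unary.Any as Any using (Any; here; there; any?)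
open import Data.List.Relation.Unary.Unique.Propositional using (Unique)
import Data.List.Relation.Unary.Unique.Propositional.Properties as Unique
import Data.List.Relation.Unary.Unique.DecPropositional.Properties as UniqueDec
open import Data.Maybe.Base using (Maybe; just; nothing; is-just)
import Data.Maybe.Properties as Maybe
open import Data.Nat.Base
open import Data.Nat.DivMod using (_mod_; m%n<n; m<n⇒m%n≡m)
open import Data.Nat.Properties renaming (_≟_ to _≟ⁿ_)
open import Data.Nat.Tactic.RingSolver using (solve-∀)
open import Data.Product.Base using (∃; ∃-syntax; Σ-syntax; _×_; _,_; proj₁; proj₂)
import Data.Product.Properties as Product
open import Data.Sum.Base using (_⊎_; inj₁; inj₂; [_,_]′)
open import Data.Vec.Base using (Vec; []; _∷_; lookup; tabulate; _[_]≔_)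
import Data.Vec.Properties as Vec
open import Function.Base using (_∘_; case_of_)
open import Function.Bundles using (Equivalence; mk⇔)
open import Function.Definitions using (Injective)
open import Level using (0ℓ)
open import Relation.Binary.Construct.Closure.ReflexiveTransitive using (Star; ε; _◅_; _◅◅_)
open import Relation.Binary.Definitions using (DecidableEquality; Decidable)
open import Relation.Binary.PropositionalEquality hiding ([_])
open import Relation.Nullary
open import Relation.Nullary.Decidable using (map′; ¬?; decidable-stable; dec-true; True; toWitness)
open import Relation.Unary using (Pred)
import Relation.Unary as U

-- Finite lists and decidable search

module _ {A : Set} where

  module _ (_≟ᴬ_ : DecidableEquality A) where

    Unique-⊆⇒length≤ : ∀ {xs ys : List A} → Unique xs → xs ⊆ ys → length xs ≤ length ys
    Unique-⊆⇒length≤ {[]}     {ys} _         _     = z≤n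
    Unique-⊆⇒length≤ {x ∷ xs} {ys} (x≢ ∷ !xs) xs⊆ys = ≤-trans
      (s≤s (Unique-⊆⇒length≤ !xs λ y∈xs → ∈-filter⁺ (λ y → ¬? (x ≟ᴬ y)) (xs⊆ys (there y∈xs)) (All.lookup x≢ y∈xs)))
      (filter-notAll (λ y → ¬? (x ≟ᴬ y)) ys (Any.map (λ x≡y x≢y → x≢y x≡y) (xs⊆ys (here refl))))

  sublists : List A → List (List A)
  sublists []       = [ [] ]
  sublists (x ∷ xs) = map (x ∷_) (sublists xs) ++ sublists xs

  filter∈sublists : ∀ {P : Pred A 0ℓ} (P? : U.Decidable P) xs → filter P? xs ∈ sublists xs
  filter∈sublists P? []       = here refl
  filter∈sublists P? (x ∷ xs) with P? x
  ... | yes _ = ∈-++⁺ˡ (∈-map⁺ (x ∷_) (filter∈sublists P? xs))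
  ... | no  _ = ∈-++⁺ʳ (map (x ∷_) (sublists xs)) (filter∈sublists P? xs)

  vectors : List A → ∀ n → List (Vec A n)
  vectors xs zero    = [ [] ]
  vectors xs (suc n) = cartesianProductWith _∷_ xs (vectors xs n)

  ∈-vectors : ∀ {xs} → (∀ x → x ∈ xs) → ∀ {n} (v : Vec A n) → v ∈ vectors xs n
  ∈-vectors all []      = here refl
  ∈-vectors all (x ∷ v) = ∈-cartesianProductWith⁺ _∷_ (all x) (∈-vectors all v)

-- It suffices that whenever some witness exists, another one lies in `xs`. This makes it possible
-- to search infinite types such as lists of clauses, with canonical lists as representatives.
∃-dec : ∀ {A : Set} {P : Pred A 0ℓ} (xs : List A) → (∀ {x} → P x → ∃[ y ] y ∈ xs × P y) →
        U.Decidable P → Dec (∃ P)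
∃-dec xs complete P? = map′ (λ a → let x , _ , p = find a in x , p)
  (λ (x , p) → let y , y∈xs , q = complete p in lose y∈xs q) (any? P? xs)

-- Paths whose intermediate points are in vs; deciding their existence by
-- recursion on vs is Warshall's algorithm.
module Warshall {A : Set} (R : A → A → Set) (R? : Decidable R) where

  data Via (vs : List A) (a b : A) : Set where
    edge : R a b → Via vs a b
    step : ∀ {c} → c ∈ vs → R a c → Via vs c b → Via vs a b

  weaken-via : ∀ {vs v a b} → Via vs a b → Via (v ∷ vs) a b
  weaken-via (edge r)     = edge r
  weaken-via (step i r p) = step (there i) r (weaken-via p)

  join-via : ∀ {vs v a b} → Via vs a v → Via (v ∷ vs) v b → Via (v ∷ vs) a b
  join-via (edge r)     q = step (here refl) r q
  join-via (step i r p) q = step (there i) r (join-via p q)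

  -- The part up to the first visit to `v` and the part from the last visit on are kept; loops at
  -- `v` between them are dropped.
  split-via : ∀ {vs v a b} → Via (v ∷ vs) a b → Via vs a b ⊎ Via vs a v × Via vs v b
  split-via (edge r) = inj₁ (edge r)
  split-via (step i r p) with i | split-via p
  ... | here refl | inj₁ q       = inj₂ (edge r , q)
  ... | here refl | inj₂ (_ , q) = inj₂ (edge r , q)
  ... | there j   | inj₁ q       = inj₁ (step j r q)
  ... | there j   | inj₂ (q , s) = inj₂ (step j r q , s)

  via? : ∀ vs a b → Dec (Via vs a b)
  via? []       a b = map′ edge (λ { (edge r) → r }) (R? a b)
  via? (v ∷ vs) a b = map′
    [ weaken-via , (λ (p , q) → join-via p (weaken-via q)) ]′ split-via
    (via? vs a b ⊎-dec (via? vs a v ×-dec via? vs v b))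

  via⇒star : ∀ {vs a b} → Via vs a b → Star R a b
  via⇒star (edge r)     = r ◅ ε
  via⇒star (step _ r p) = r ◅ via⇒star p

least : ∀ {P : ℕ → Set} → (∀ n → Dec (P n)) → ∀ n → P n → ∃[ m ] P m × (∀ k → P k → m ≤ k)
least P? n p with P? 0
least P? n       p | yes q = 0 , q , λ _ _ → z≤n
least P? zero    p | no ¬q = ⊥-elim (¬q p)
least P? (suc n) p | no ¬q with least (P? ∘ suc) n p
... | m , q , minimal = suc m , q , λ where
  zero    r → ⊥-elim (¬q r)
  (suc k) r → s≤s (minimal k r)

-- Only thresholds `f a ≤ m` have to be decided; by antisymmetry the least threshold that is met is
-- a value of `f`.
minimum : {A : Set} (f : A → ℕ) (a : A) → (∀ m → Dec (∃[ a ] f a ≤ m)) → ∃[ m ] m IsMinimumOf f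
minimum f a f≤? with least f≤? (f a) (a , ≤-refl)
... | m , (b , fb≤m) , minimal =
  m , (b , ≤-antisym fb≤m (minimal (f b) (b , ≤-refl))) , λ c → minimal (f c) (c , ≤-refl)


-- Clause sets

module _ {v : ℕ} where

  open import Data.List.Membership.DecPropositional (_≟_ {v}) public using (_∈?_)

  _⊆?_ : Decidable (_⊆_ {A = Clause v})
  S ⊆? T = map′ (λ a {x} x∈S → All.lookup a x∈S) (λ S⊆T → All.tabulate S⊆T) (All.all? (_∈? T) S)

  card≤ : ∀ {S T : ClauseSet v} → S ⊆ T → card S ≤ length T
  card≤ {S} S⊆T = Unique-⊆⇒length≤ _≟_ (UniqueDec.deduplicate-! _≟_ S) (S⊆T ∘ ∈-deduplicate⁻ _≟_ S)

  card-mono : ∀ {S T : ClauseSet v} → S ⊆ T → card S ≤ card T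
  card-mono {S} {T} S⊆T = Unique-⊆⇒length≤ _≟_ (UniqueDec.deduplicate-! _≟_ S)
    (∈-deduplicate⁺ _≟_ ∘ S⊆T ∘ ∈-deduplicate⁻ _≟_ S)

  allClauses : List (Clause v)
  allClauses = deduplicate _≟_ (vectors (nothing ∷ just true ∷ just false ∷ []) v)

  ∈-allClauses : ∀ C → C ∈ allClauses
  ∈-allClauses C = ∈-deduplicate⁺ _≟_ (∈-vectors complete C)
    where
    complete : ∀ l → l ∈ nothing ∷ just true ∷ just false ∷ []
    complete nothing      = here refl
    complete (just true)  = there (here refl)
    complete (just false) = there (there (here refl))

  -- A representative with the same elements as `S`, taken from the finite list
  -- `sublists allClauses`. Deduplication of `allClauses` keeps it free of repetitions, as
  -- `canonical-card` requires.
  canonical : ClauseSet v → ClauseSet v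
  canonical S = filter (_∈? S) allClauses

  canonical-⊆ : ∀ S → canonical S ⊆ S
  canonical-⊆ S = proj₂ ∘ ∈-filter⁻ (_∈? S) {xs = allClauses}

  ⊆-canonical : ∀ S → S ⊆ canonical S
  ⊆-canonical S {C} C∈S = ∈-filter⁺ (_∈? S) (∈-allClauses C) C∈S

  canonical-∈ : ∀ S → canonical S ∈ sublists allClauses
  canonical-∈ S = filter∈sublists (_∈? S) allClauses

  canonical-card : ∀ S → length (canonical S) ≤ card S
  canonical-card S = Unique-⊆⇒length≤ _≟_
    (Unique.filter⁺ (_∈? S) (UniqueDec.deduplicate-! _≟_ (vectors _ v)))
    (∈-deduplicate⁺ _≟_ ∘ canonical-⊆ S)

  disjunction? : (B C R : Clause v) → Dec (IsDisjunction B C R)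
  disjunction? B C R = map′
    (λ d (x , b) → mk⇔ (proj₁ (d x b)) (proj₂ (d x b)))
    (λ d x b → Equivalence.to (d (x , b)) , Equivalence.from (d (x , b)))
    (Fin.all? λ x → allBool? λ b →
      ((x , b) ∈ᶜ? R →-dec ((x , b) ∈ᶜ? B ⊎-dec (x , b) ∈ᶜ? C)) ×-dec
      (((x , b) ∈ᶜ? B ⊎-dec (x , b) ∈ᶜ? C) →-dec (x , b) ∈ᶜ? R))
    where
    _∈ᶜ?_ : Decidable (_∈ᶜ_ {v})
    (x , b) ∈ᶜ? C = Maybe.≡-dec Bool._≟_ (lookup C x) (just b)

    allBool? : ∀ {P : Bool → Set} → (∀ b → Dec (P b)) → Dec (∀ b → P b)
    allBool? P? = map′ (λ { (t , f) true → t ; (t , f) false → f }) (λ p → p true , p false)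
      (P? true ×-dec P? false)

  -- The decomposition of a premise as B ∨ x is determined by x, as x does not occur in B.
  Resolves : Clause v → Clause v → Clause v → Fin v → Set
  Resolves P Q R x = lookup P x ≡ just true × lookup Q x ≡ just false ×
    IsDisjunction (P [ x ]≔ nothing) (Q [ x ]≔ nothing) R

  resolves? : ∀ P Q R x → Dec (Resolves P Q R x)
  resolves? P Q R x =
    Maybe.≡-dec Bool._≟_ (lookup P x) (just true) ×-dec
    Maybe.≡-dec Bool._≟_ (lookup Q x) (just false) ×-dec
    disjunction? (P [ x ]≔ nothing) (Q [ x ]≔ nothing) R

  reinsert : ∀ (P : Clause v) x {b} → lookup P x ≡ just b → P ≡ (P [ x ]≔ nothing) [ x ]≔ just b
  reinsert P x {b} Px = sym (begin
    (P [ x ]≔ nothing) [ x ]≔ just b ≡⟨ Vec.[]≔-idempotent P x ⟩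
    P [ x ]≔ just b                  ≡⟨ cong (P [ x ]≔_) Px ⟨
    P [ x ]≔ lookup P x              ≡⟨ Vec.[]≔-lookup P x ⟩
    P                                ∎)
    where open ≡-Reasoning

  remove : ∀ {P B : Clause v} {x b} → lookup B x ≡ nothing → P ≡ B [ x ]≔ just b → P [ x ]≔ nothing ≡ B
  remove {P} {B} {x} {b} Bx P≡ = begin
    P [ x ]≔ nothing                 ≡⟨ cong (_[ x ]≔ nothing) P≡ ⟩
    (B [ x ]≔ just b) [ x ]≔ nothing ≡⟨ Vec.[]≔-idempotent B x ⟩
    B [ x ]≔ nothing                 ≡⟨ cong (B [ x ]≔_) Bx ⟨
    B [ x ]≔ lookup B x              ≡⟨ Vec.[]≔-lookup B x ⟩
    B                                ∎
    where open ≡-Reasoning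

  resolves⇒resolvent : ∀ {P Q R} → ∃ (Resolves P Q R) → IsResolvent P Q R
  resolves⇒resolvent {P} {Q} (x , Px , Qx , d) = record
    { x = x ; B = P [ x ]≔ nothing ; C = Q [ x ]≔ nothing
    ; x∉B = Vec.lookup∘updateAt x P ; x∉C = Vec.lookup∘updateAt x Q
    ; P≡B∨x = reinsert P x Px ; Q≡C∨¬x = reinsert Q x Qx ; R≡B∨C = d }

  resolvent⇒resolves : ∀ {P Q R} → IsResolvent P Q R → ∃ (Resolves P Q R)
  resolvent⇒resolves {P} {Q} {R} r = x
    , trans (cong (λ D → lookup D x) P≡B∨x) (Vec.lookup∘updateAt x B)
    , trans (cong (λ D → lookup D x) Q≡C∨¬x) (Vec.lookup∘updateAt x C)
    , subst₂ (λ B C → IsDisjunction B C R) (sym (remove x∉B P≡B∨x)) (sym (remove x∉C Q≡C∨¬x)) R≡B∨C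
    where open IsResolvent r

  resolvent? : (P Q R : Clause v) → Dec (IsResolvent P Q R)
  resolvent? P Q R = map′ resolves⇒resolvent resolvent⇒resolves (Fin.any? (resolves? P Q R))

-- Derivations up to equality of clause sets

data Derivable {v} (F : CNF v) (S : ClauseSet v) (C : Clause v) : Set where
  axiom     : C ∈ F → Derivable F S C
  resolvent : ∀ {P Q} → P ∈ S → Q ∈ S → IsResolvent P Q C → Derivable F S C

derivable? : ∀ {v} (F : CNF v) S C → Dec (Derivable F S C)
derivable? F S C = map′
  [ axiom , (λ a → let P , P∈S , b = find a ; Q , Q∈S , r = find b in resolvent P∈S Q∈S r) ]′
  (λ { (axiom C∈F) → inj₁ C∈F ; (resolvent P∈S Q∈S r) → inj₂ (lose P∈S (lose Q∈S r)) })
  (C ∈? F ⊎-dec any? (λ P → any? (λ Q → resolvent? P Q C) S) S)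

Derivable-mono : ∀ {v} {F : CNF v} {S T C} → S ⊆ T → Derivable F S C → Derivable F T C
Derivable-mono S⊆T (axiom C∈F)           = axiom C∈F
Derivable-mono S⊆T (resolvent P∈S Q∈S r) = resolvent (S⊆T P∈S) (S⊆T Q∈S) r

derive : ∀ {v} {F : CNF v} {S C} → Derivable F S C → Step F S (C ∷ S)
derive (axiom C∈F)           = download C∈F
derive (resolvent P∈S Q∈S r) = infer P∈S Q∈S r

-- A decidable bound on single configurations that survives the removal of clauses. Space, width and
-- containment in a fixed set are of this kind, so that one search serves all three measures.
record DownSet (v : ℕ) : Set₁ where
  field
    Holds : ClauseSet v → Set
    holds? : U.Decidable Holds
    down  : ∀ {S T} → S ⊆ T → Holds T → Holds S

module Moves {v} (F : CNF v) (G : DownSet v) where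

  open DownSet G

  -- Unlike steps, moves include arbitrary erasures and depend on lists only as sets. `extend` asks
  -- for `Holds (C ∷ S)` because a derivation passes through `C ∷ S` before erasing down to `T`.
  data Move (S T : ClauseSet v) : Set where
    weaken : T ⊆ S → Holds T → Move S T
    extend : ∀ {C} → Derivable F S C → T ⊆ C ∷ S → Holds (C ∷ S) → Move S T

  move? : Decidable Move
  move? S T = map′ to from ((T ⊆? S ×-dec holds? T) ⊎-dec
    ∃-dec allClauses (λ {C} p → C , ∈-allClauses C , p)
      (λ C → derivable? F S C ×-dec T ⊆? (C ∷ S) ×-dec holds? (C ∷ S)))
    where
    Cases : Set
    Cases = (T ⊆ S × Holds T) ⊎ (∃[ C ] Derivable F S C × T ⊆ C ∷ S × Holds (C ∷ S))

    to : Cases → Move S T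
    to (inj₁ (i , h))         = weaken i h
    to (inj₂ (C , d , i , h)) = extend d i h

    from : Move S T → Cases
    from (weaken i h)       = inj₁ ((λ {_} → i) , h)
    from (extend {C} d i h) = inj₂ (C , d , (λ {_} → i) , h)

  move-resp : ∀ {S S′ T T′} → S ⊆ S′ → S′ ⊆ S → T′ ⊆ T → Move S T → Move S′ T′
  move-resp S⊆ S⊇ T⊇ (weaken i h)     = weaken (S⊆ ∘ i ∘ T⊇) (down T⊇ h)
  move-resp S⊆ S⊇ T⊇ (extend {C} d i h) = extend (Derivable-mono S⊆ d) (∷⁺ʳ C S⊆ ∘ i ∘ T⊇) (down (∷⁺ʳ C S⊇) h)

  AllHold : ∀ {S T} → Star (Step F) S T → Set
  AllHold π = All Holds (configurations π)

  AllHold-◅◅ : ∀ {S T U} (π : Star (Step F) S T) {ρ : Star (Step F) T U} → AllHold π → AllHold ρ → AllHold (π ◅◅ ρ)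
  AllHold-◅◅ ε       _        hs = hs
  AllHold-◅◅ (_ ◅ π) (h ∷ gs) hs = h ∷ AllHold-◅◅ π gs hs

  Reaches : ClauseSet v → ClauseSet v → Set
  Reaches S T = Σ[ π ∈ Star (Step F) S T ] AllHold π

  eraseAll : ∀ L S → Holds S → ∃[ T ] (∀ C → C ∈ T → C ∈ S × C ∉ L) ×
    (∀ C → C ∈ S → C ∉ L → C ∈ T) × Reaches S T
  eraseAll []      S h = S , (λ _ C∈S → C∈S , λ ()) , (λ _ C∈S _ → C∈S) , ε , h ∷ []
  eraseAll (D ∷ L) S h with D ∈? S
  ... | no D∉S =
    let T , sound , complete , π = eraseAll L S h
    in T , (λ C C∈T → let C∈S , C∉L = sound C C∈T in
              C∈S , λ { (here refl) → D∉S C∈S ; (there C∈L) → C∉L C∈L })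
         , (λ C C∈S C∉ → complete C C∈S (C∉ ∘ there)) , π
  ... | yes D∈S =
    let other = λ E → ¬? (E ≟ D)
        T , sound , complete , π , hs = eraseAll L (filter other S) (down (filter-⊆ other S) h)
    in T , (λ C C∈T → let C∈S′ , C∉L = sound C C∈T ; C∈S , C≢D = ∈-filter⁻ other {xs = S} C∈S′ in
              C∈S , λ { (here C≡D) → C≢D C≡D ; (there C∈L) → C∉L C∈L })
         , (λ C C∈S C∉ → complete C (∈-filter⁺ other C∈S (C∉ ∘ here)) (C∉ ∘ there))
         , erase D∈S ◅ π , h ∷ hs

  eraseTo : ∀ S T → T ⊆ S → Holds S → ∃[ T′ ] (∀ C → C ∈ T′ → C ∈ T) × T ⊆ T′ × Reaches S T′
  eraseTo S T T⊆S h =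
    let outside = λ C → ¬? (C ∈? T)
        L = filter outside S
        T′ , sound , complete , π = eraseAll L S h
    in T′ , (λ C C∈T′ → let C∈S , C∉L = sound C C∈T′ in
               decidable-stable (C ∈? T) λ C∉T → C∉L (∈-filter⁺ outside C∈S C∉T))
          , (λ {C} C∈T → complete C (T⊆S C∈T) λ C∈L → proj₂ (∈-filter⁻ outside {xs = S} C∈L) C∈T) , π

  eraseThen : ∀ {S T U} → T ⊆ S → Holds S →
    (∀ {T′} → T′ ⊆ T → T ⊆ T′ → ∃[ U′ ] (∀ C → C ∈ U′ → C ∈ U) × U ⊆ U′ × Reaches T′ U′) →
    ∃[ U′ ] (∀ C → C ∈ U′ → C ∈ U) × U ⊆ U′ × Reaches S U′
  eraseThen {S} {T} T⊆S h continue with eraseTo S T T⊆S h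
  ... | T′ , T⊇ , T⊆ , π , hs with continue (λ {C} → T⊇ C) T⊆
  ... | U′ , U⊇ , U⊆ , ρ , gs = U′ , U⊇ , U⊆ , π ◅◅ ρ , AllHold-◅◅ π hs gs

  -- Erasing by filtering reaches a target only up to order and repetitions. The start is therefore
  -- generalised to any `S′` with the elements of `S`, so that each move can take up where the
  -- previous one ended.
  realize : ∀ {S T} → Star Move S T → ∀ {S′} → S′ ⊆ S → S ⊆ S′ → Holds S →
    ∃[ T′ ] (∀ C → C ∈ T′ → C ∈ T) × T ⊆ T′ × Reaches S′ T′
  realize ε                       {S′} S⊇ S⊆ h = S′ , (λ C → S⊇) , S⊆ , ε , down S⊇ h ∷ []
  realize (weaken T⊆S g ◅ μ)      {S′} S⊇ S⊆ h =
    eraseThen (S⊆ ∘ T⊆S) (down S⊇ h) λ T⊇ T⊆ → realize μ T⊇ T⊆ g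
  realize (extend {C} d T⊆ g ◅ μ) {S′} S⊇ S⊆ h
    with eraseThen (∷⁺ʳ C S⊆ ∘ T⊆) (down (∷⁺ʳ C S⊇) g) (λ T⊇ T⊆′ → realize μ T⊇ T⊆′ (down T⊆ g))
  ... | U′ , U⊇ , U⊆ , π , hs = U′ , U⊇ , U⊆ , derive (Derivable-mono S⊆ d) ◅ π , down S⊇ h ∷ hs

  BoundedRefutation : Set
  BoundedRefutation = Σ[ π ∈ Refutation F ] AllHold (Refutation.derivation π)

  moves⇒refutation : Holds [] → Star Move [] [ 𝟘 ] → BoundedRefutation
  moves⇒refutation h μ with realize μ (λ x → x) (λ x → x) h
  ... | T , T⊇ , T⊆ , π , hs = record
    { final = T ; derivation = π ; final≡[𝟘] = λ {C} → mk⇔ (T⊇ C) T⊆ } , hs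

  step⇒move : ∀ {S T} → Step F S T → Holds T → Move S T
  step⇒move (download C∈F)      h = extend (axiom C∈F) (λ x → x) h
  step⇒move (erase {C = C} _)   h = weaken (filter-⊆ _ _) h
  step⇒move (infer P∈S Q∈S r)   h = extend (resolvent P∈S Q∈S r) (λ x → x) h

  source-holds : ∀ {S T} (π : Star (Step F) S T) → AllHold π → Holds S
  source-holds ε       (h ∷ _) = h
  source-holds (_ ◅ _) (h ∷ _) = h

  open Warshall Move move?

  -- Each intermediate configuration is replaced by its canonical list, which keeps the path in the
  -- finite graph that `via?` searches.
  steps⇒via : ∀ {S T} (π : Star (Step F) S T) → AllHold π → T ⊆ [ 𝟘 ] → [ 𝟘 ] ⊆ T →
    ∀ {S′} → S ⊆ S′ → S′ ⊆ S → Via (sublists allClauses) S′ [ 𝟘 ]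
  steps⇒via ε             (h ∷ _)  T⊆ T⊇ S⊆ S⊇ = edge (weaken (S⊆ ∘ T⊇) (down T⊇ h))
  steps⇒via (_◅_ {j = S₁} s π) (_ ∷ hs) T⊆ T⊇ S⊆ S⊇ = step (canonical-∈ S₁)
    (move-resp S⊆ S⊇ (canonical-⊆ S₁) (step⇒move s (source-holds π hs)))
    (steps⇒via π hs T⊆ T⊇ (⊆-canonical S₁) (canonical-⊆ S₁))

  refutation? : Dec BoundedRefutation
  -- Moves check `Holds` only for configurations after the start, so the empty one is checked
  -- separately.
  refutation? with holds? []
  ... | no ¬h = no λ (π , hs) → ¬h (source-holds (Refutation.derivation π) hs)
  ... | yes h = map′ (moves⇒refutation h ∘ via⇒star)
    (λ (π , hs) → let open Refutation π in
      steps⇒via derivation hs (λ {C} → Equivalence.to final≡[𝟘]) (λ {C} → Equivalence.from final≡[𝟘]) (λ x → x) (λ x → x))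
    (via? (sublists allClauses) [] [ 𝟘 ])

-- Minimal measures

module _ {v} {F : CNF v} where

  open Refutation

  spaceAtMost : ℕ → DownSet v
  spaceAtMost m = record
    { Holds = λ S → card S ≤ m ; holds? = λ S → card S ≤? m
    ; down = λ S⊆T → ≤-trans (card-mono S⊆T) }

  widthAtMost : ℕ → DownSet v
  widthAtMost m = record
    { Holds = All (λ C → ∣ C ∣ᶜ ≤ m) ; holds? = All.all? (λ C → ∣ C ∣ᶜ ≤? m)
    ; down = λ S⊆T a → All.tabulate (All.lookup a ∘ S⊆T) }

  within : ClauseSet v → DownSet v
  within B = record
    { Holds = _⊆ B ; holds? = _⊆? B ; down = λ S⊆T T⊆B → T⊆B ∘ S⊆T }

  max≤⇒ : ∀ {m} ns → max 0 ns ≤ m → All (_≤ m) ns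
  max≤⇒ ns p = All.map (λ q → ≤-trans q p) (xs≤max 0 ns)

  space≤⇒ : ∀ {m} (π : Refutation F) → refSpace π ≤ m → All (λ S → card S ≤ m) (configurations (derivation π))
  space≤⇒ π p = All.map⁻ (max≤⇒ _ p)

  space≤⇐ : ∀ {m} (π : Refutation F) → All (λ S → card S ≤ m) (configurations (derivation π)) → refSpace π ≤ m
  space≤⇐ π a = max≤v⁺ z≤n (All.map⁺ a)

  width≤⇐ : ∀ {m} (π : Refutation F) → All (All (λ C → ∣ C ∣ᶜ ≤ m)) (configurations (derivation π)) → refWidth π ≤ m
  width≤⇐ π a = max≤v⁺ z≤n (All.map⁺ (All.concat⁺ a))

  concat-⊆ : ∀ {B : ClauseSet v} Ss → All (_⊆ B) Ss → concat Ss ⊆ B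
  concat-⊆ Ss a x = let S , x∈S , S∈ = ∈-concat⁻′ Ss x in All.lookup a S∈ x∈S

  length≤⇐ : ∀ {B} (π : Refutation F) → All (_⊆ B) (configurations (derivation π)) → refLength π ≤ length B
  length≤⇐ π a = card≤ (concat-⊆ _ a)

  minimumSpace : Refutation F → ∃[ m ] Sp[ F ⊢0]≡ m
  minimumSpace π = minimum refSpace π λ m → map′
    (λ (ρ , a) → ρ , space≤⇐ ρ a) (λ (ρ , p) → ρ , space≤⇒ ρ p)
    (Moves.refutation? F (spaceAtMost m))

  minimumWidth : Refutation F → ∃[ m ] W[ F ⊢0]≡ m
  minimumWidth π = minimum refWidth π λ m → map′
    (λ (ρ , a) → ρ , width≤⇐ ρ a)
    (λ (ρ , p) → ρ , All.concat⁻ (All.map⁻ (max≤⇒ _ p)))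
    (Moves.refutation? F (widthAtMost m))

  -- Length concerns all configurations together. It is at most `m` when some `B` of at most `m`
  -- clauses contains every configuration; for a fixed `B` this is a bound on single configurations,
  -- and there are finitely many canonical `B`.
  minimumLength : Refutation F → ∃[ m ] L[ F ⊢0]≡ m
  minimumLength π = minimum refLength π λ m → map′
    (λ (B , B≤m , ρ , a) → ρ , ≤-trans (length≤⇐ ρ a) B≤m)
    (λ (ρ , p) → _ , bounded ρ p)
    (∃-dec {P = λ B → length B ≤ m × Moves.BoundedRefutation F (within B)} (sublists allClauses)
      (λ {B} → restrict {B})
      (λ B → length B ≤? m ×-dec Moves.refutation? F (within B)))
    where
    clauses : Refutation F → ClauseSet v
    clauses ρ = concat (configurations (derivation ρ))

    bounded : ∀ {m} (ρ : Refutation F) → refLength ρ ≤ m →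
      length (canonical (clauses ρ)) ≤ m × Moves.BoundedRefutation F (within (canonical (clauses ρ)))
    bounded ρ p = ≤-trans (canonical-card (clauses ρ)) p , ρ ,
      All.tabulate λ S∈ x∈S → ⊆-canonical (clauses ρ) (∈-concat⁺′ x∈S S∈)

    restrict : ∀ {B m} → length B ≤ m × Moves.BoundedRefutation F (within B) →
      ∃[ B′ ] B′ ∈ sublists allClauses × length B′ ≤ m × Moves.BoundedRefutation F (within B′)
    restrict (B≤m , ρ , a) = _ , canonical-∈ (clauses ρ) , bounded ρ (≤-trans (length≤⇐ ρ a) B≤m)

module _ {A B : Set} (f : A → B) where

  ∈-map-++ˡ : ∀ xs {ys} {b : B} → b ∈ map f xs → b ∈ map f (xs ++ ys)
  ∈-map-++ˡ xs {ys} b∈ = subst (_∈_ _) (sym (map-++ f xs ys)) (∈-++⁺ˡ b∈)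

  ∈-map-++ʳ : ∀ xs {ys} {b : B} → b ∈ map f ys → b ∈ map f (xs ++ ys)
  ∈-map-++ʳ xs {ys} b∈ = subst (_∈_ _) (sym (map-++ f xs ys)) (∈-++⁺ʳ (map f xs) b∈)

  ∈-map-++⁻ : ∀ xs {ys} {b : B} → b ∈ map f (xs ++ ys) → b ∈ map f xs ⊎ b ∈ map f ys
  ∈-map-++⁻ xs {ys} b∈ = ∈-++⁻ (map f xs) (subst (_∈_ _) (map-++ f xs ys) b∈)

-- Augmenting paths

module Hall {A B : Set} (_≟ᴮ_ : DecidableEquality B) (N : A → List B) where

  open import Data.List.Membership.DecPropositional _≟ᴮ_ using () renaming (_∈?_ to _∈ᴮ?_)

  Pairs : Set
  Pairs = List (A × B)

  dom : Pairs → List A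
  dom = map proj₁

  im : Pairs → List B
  im = map proj₂

  -- A partial choice of representatives outside the forbidden set `X`. In the application `A`
  -- consists of clauses and `B` of vertices, and `unique` ensures that no vertex serves two
  -- clauses.
  record Matching (X : List B) (m : Pairs) : Set where
    constructor mkMatching
    field
      unique : Unique (im m)
      edge   : ∀ {a b} → (a , b) ∈ m → b ∈ N a
      avoid  : ∀ {a b} → (a , b) ∈ m → b ∉ X

  open Matching

  avoid-im : ∀ {X m b} → Matching X m → b ∈ im m → b ∉ X
  avoid-im M b∈ with ∈-map⁻ proj₂ b∈
  ... | _ , ab∈ , refl = avoid M ab∈

  relax : ∀ {X Y m} → X ⊆ Y → Matching Y m → Matching X m
  relax X⊆Y M = mkMatching (unique M) (edge M) (λ ab∈ b∈X → avoid M ab∈ (X⊆Y b∈X))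

  cons : ∀ {X m a b} → b ∈ N a → b ∉ X → Matching (b ∷ X) m → Matching X ((a , b) ∷ m)
  cons b∈Na b∉X M = mkMatching
    (All.tabulate (λ c∈ b≡c → avoid-im M c∈ (here (sym b≡c))) ∷ unique M)
    (λ { (here refl) → b∈Na ; (there ab∈) → edge M ab∈ })
    (λ { (here refl) → b∉X ; (there ab∈) → avoid M ab∈ ∘ there })

  append : ∀ {X Y m n} → X ⊆ Y → im m ⊆ Y → Matching X m → Matching Y n → Matching X (m ++ n)
  append {m = m} {n} X⊆Y im⊆Y M N = mkMatching
    (subst Unique (sym (map-++ proj₂ m n))
      (Unique.++⁺ (unique M) (unique N) (λ (b∈m , b∈n) → avoid-im N b∈n (im⊆Y b∈m))))
    (λ ab∈ → [ edge M , edge N ]′ (∈-++⁻ m ab∈))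
    (λ ab∈ → [ avoid M , avoid (relax X⊆Y N) ]′ (∈-++⁻ m ab∈))

  im-injective : ∀ {m p q} → Unique (im m) → p ∈ m → q ∈ m → proj₂ p ≡ proj₂ q → p ≡ q
  im-injective _         (here refl) (here refl) _  = refl
  im-injective (≉ ∷ _)   (here refl) (there q∈)  eq = ⊥-elim (All.lookup ≉ (∈-map⁺ proj₂ q∈) eq)
  im-injective (≉ ∷ _)   (there p∈)  (here refl) eq = ⊥-elim (All.lookup ≉ (∈-map⁺ proj₂ p∈) (sym eq))
  im-injective (_ ∷ !m)  (there p∈)  (there q∈)  eq = im-injective !m p∈ q∈ eq

  remove-im : ∀ {X m a b} → Matching X m → (a , b) ∈ m →
    ∃[ m₀ ] Matching (b ∷ X) m₀ × length m₀ < length m × (∀ {c} → c ∈ dom m → c ∈ a ∷ dom m₀)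
  remove-im {X} {m} {a} {b} M ab∈ = m₀ , mkMatching
      (filter-unique m (unique M)) (edge M ∘ proj₁ ∘ split)
      (λ { cd∈ (here refl) → proj₂ (split cd∈) refl ; cd∈ (there d∈X) → avoid M (proj₁ (split cd∈)) d∈X })
    , filter-notAll other m (Any.map (λ { refl b≢b → b≢b refl }) ab∈)
    , cover
    where
    other : ∀ (p : A × B) → Dec (proj₂ p ≢ b)
    other p = ¬? (proj₂ p ≟ᴮ b)

    m₀ : Pairs
    m₀ = filter other m

    split : ∀ {p} → p ∈ m₀ → p ∈ m × proj₂ p ≢ b
    split = ∈-filter⁻ other

    filter-unique : ∀ m → Unique (im m) → Unique (im (filter other m))
    filter-unique []      _ = []
    filter-unique (p ∷ m) (≉ ∷ !m) with proj₂ p ≟ᴮ b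
    ... | yes _ = filter-unique m !m
    ... | no  _ = All.tabulate (λ c∈ eq → let q , q∈ , c≡ = ∈-map⁻ proj₂ c∈ in
                    All.lookup ≉ (∈-map⁺ proj₂ (proj₁ (∈-filter⁻ other {xs = m} q∈))) (trans eq c≡))
                  ∷ filter-unique m !m

    cover : ∀ {c} → c ∈ dom m → c ∈ a ∷ dom m₀
    cover c∈ with ∈-map⁻ proj₁ c∈
    ... | p , p∈ , refl with proj₂ p ≟ᴮ b
    ...   | yes eq = here (cong proj₁ (im-injective (unique M) p∈ ab∈ eq))
    ...   | no  neq = there (∈-map⁺ proj₁ (∈-filter⁺ other p∈ neq))

  record Augmented (X : List B) (m : Pairs) (c : A) : Set where
    field
      m′       : Pairs
      matching : Matching X m′
      covers   : ∀ {a} → a ∈ c ∷ dom m → a ∈ dom m′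
      size≤    : length m′ ≤ suc (length m)

  -- The points of c ∷ dom m₁ are those reached from c by alternating paths.
  record Saturated (X : List B) (m : Pairs) (c : A) : Set where
    field
      Y         : List B
      m₁ m₂     : Pairs
      X⊆Y       : X ⊆ Y
      im⊆Y      : im m₁ ⊆ Y
      size≤     : length Y + length m₂ ≤ length X + length m
      parts≤    : length m₁ + length m₂ ≤ length m
      matching₁ : Matching X m₁
      matching₂ : Matching Y m₂
      covers    : ∀ {a} → a ∈ dom m → a ∈ dom m₁ ⊎ a ∈ dom m₂
      saturated : ∀ {a} → a ∈ c ∷ dom m₁ → N a ⊆ Y

  augment : ∀ n {X m} c → length m ≤ n → Matching X m → Augmented X m c ⊎ Saturated X m c
  augment n {X} {m} c m≤n M with any? (λ b → ¬? (b ∈ᴮ? X)) (N c)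
  ... | no ¬a = inj₂ record
    { Y = X ; m₁ = [] ; m₂ = m ; X⊆Y = λ b∈ → b∈ ; im⊆Y = λ () ; size≤ = ≤-refl ; parts≤ = ≤-refl
    ; matching₁ = mkMatching [] (λ ()) (λ ()) ; matching₂ = M ; covers = inj₂
    ; saturated = λ { (here refl) {b} b∈N → decidable-stable (b ∈ᴮ? X) (λ b∉X → ¬a (lose b∈N b∉X)) } }
  ... | yes a with find a
  ...   | b , b∈N , b∉X with b ∈ᴮ? im m
  ...     | no b∉m = inj₁ record
    { m′ = (c , b) ∷ m
    ; matching = cons b∈N b∉X (mkMatching (unique M) (edge M)
        λ { cd∈ (here refl) → b∉m (∈-map⁺ proj₂ cd∈) ; cd∈ (there d∈X) → avoid M cd∈ d∈X })
    ; covers = λ a∈ → a∈ ; size≤ = ≤-refl }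
  ...     | yes b∈m with ∈-map⁻ proj₂ b∈m
  ...       | (d , _) , db∈m , refl with remove-im M db∈m
  ...         | m₀ , M₀ , m₀<m , cover₀ with n | ≤-trans m₀<m m≤n
  ...           | suc n | s≤s m₀≤n with augment n d m₀≤n M₀
  ...             | inj₁ A = inj₁ record
    { m′ = (c , b) ∷ A.m′
    ; matching = cons b∈N b∉X A.matching
    ; covers = λ { (here refl) → here refl ; (there a∈) → there (A.covers (cover₀ a∈)) }
    ; size≤ = s≤s (≤-trans A.size≤ m₀<m) }
    where module A = Augmented A
  ...             | inj₂ S = again (augment n c (≤-trans S.m₂≤m₀ m₀≤n) S.matching₂)
    where
    open ≤-Reasoning
    module S where
      open Saturated S public

      M₁ : Matching X ((d , b) ∷ m₁)
      M₁ = cons (edge M db∈m) b∉X matching₁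

      M₁⊆Y : im ((d , b) ∷ m₁) ⊆ Y
      M₁⊆Y (here refl) = X⊆Y (here refl)
      M₁⊆Y (there b∈)  = im⊆Y b∈

      m₂≤m₀ : length m₂ ≤ length m₀
      m₂≤m₀ = ≤-trans (m≤n+m (length m₂) (length m₁)) parts≤

      covers′ : ∀ {a} → a ∈ dom m → a ∈ dom ((d , b) ∷ m₁) ⊎ a ∈ dom m₂
      covers′ a∈ with cover₀ a∈
      ... | here refl = inj₁ (here refl)
      ... | there a∈₀ with covers a∈₀
      ...   | inj₁ a∈₁ = inj₁ (there a∈₁)
      ...   | inj₂ a∈₂ = inj₂ a∈₂

    M₁ : Pairs
    M₁ = (d , b) ∷ S.m₁

    again : Augmented S.Y S.m₂ c ⊎ Saturated S.Y S.m₂ c → Augmented X m c ⊎ Saturated X m c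
    again (inj₁ A) = inj₁ record
      { m′ = M₁ ++ A.m′
      ; matching = append (S.X⊆Y ∘ there) S.M₁⊆Y S.M₁ A.matching
      ; covers = λ where
          (here refl) → ∈-map-++ʳ proj₁ M₁ (A.covers (here refl))
          (there a∈)  → [ ∈-map-++ˡ proj₁ M₁ , ∈-map-++ʳ proj₁ M₁ ∘ A.covers ∘ there ]′ (S.covers′ a∈)
      ; size≤ = begin
          length (M₁ ++ A.m′)            ≡⟨ length-++ M₁ ⟩
          suc (length S.m₁) + length A.m′              ≤⟨ +-monoʳ-≤ (suc (length S.m₁)) A.size≤ ⟩
          suc (length S.m₁) + suc (length S.m₂)        ≡⟨ cong suc (+-suc (length S.m₁) (length S.m₂)) ⟩
          suc (suc (length S.m₁ + length S.m₂))        ≤⟨ s≤s (s≤s S.parts≤) ⟩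
          suc (suc (length m₀))                        ≤⟨ s≤s m₀<m ⟩
          suc (length m)                               ∎ }
      where module A = Augmented A
    again (inj₂ T) = inj₂ record
      { Y = T.Y ; m₁ = M₁ ++ T.m₁ ; m₂ = T.m₂
      ; X⊆Y = T.X⊆Y ∘ S.X⊆Y ∘ there
      ; im⊆Y = λ b∈ → [ T.X⊆Y ∘ S.M₁⊆Y , T.im⊆Y ]′ (∈-map-++⁻ proj₂ M₁ b∈)
      ; size≤ = begin
          length T.Y + length T.m₂       ≤⟨ T.size≤ ⟩
          length S.Y + length S.m₂       ≤⟨ S.size≤ ⟩
          suc (length X) + length m₀     ≡⟨ +-suc (length X) (length m₀) ⟨
          length X + suc (length m₀)     ≤⟨ +-monoʳ-≤ (length X) m₀<m ⟩
          length X + length m            ∎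
      ; parts≤ = begin
          length (M₁ ++ T.m₁) + length T.m₂         ≡⟨ cong (_+ length T.m₂) (length-++ M₁) ⟩
          suc (length S.m₁) + length T.m₁ + length T.m₂           ≡⟨ +-assoc (suc (length S.m₁)) (length T.m₁) (length T.m₂) ⟩
          suc (length S.m₁) + (length T.m₁ + length T.m₂)         ≤⟨ +-monoʳ-≤ (suc (length S.m₁)) T.parts≤ ⟩
          suc (length S.m₁ + length S.m₂)                         ≤⟨ s≤s S.parts≤ ⟩
          suc (length m₀)                                         ≤⟨ m₀<m ⟩
          length m                                                ∎
      ; matching₁ = append (S.X⊆Y ∘ there) S.M₁⊆Y S.M₁ T.matching₁
      ; matching₂ = T.matching₂
      ; covers = λ a∈ → [ inj₁ ∘ ∈-map-++ˡ proj₁ M₁ , [ inj₁ ∘ ∈-map-++ʳ proj₁ M₁ , inj₂ ]′ ∘ T.covers ]′ (S.covers′ a∈)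
      ; saturated = λ where
          (here refl) → T.saturated (here refl)
          (there a∈)  → saturated-at (∈-map-++⁻ proj₁ M₁ a∈) }
      where
      module T = Saturated T
      saturated-at : ∀ {a} → a ∈ dom M₁ ⊎ a ∈ dom T.m₁ → N a ⊆ T.Y
      saturated-at (inj₁ (here refl)) = T.X⊆Y ∘ S.saturated (here refl)
      saturated-at (inj₁ (there a∈))  = T.X⊆Y ∘ S.saturated (there a∈)
      saturated-at (inj₂ a∈)          = T.saturated (there a∈)

  -- A successful augmentation adds at most one to `length X + length m`. A failed one does not
  -- increase it, since the points that enlarge `X` to `Y` are paid for by matched pairs given up;
  -- the elements of those pairs and `c` then have all their neighbours in `Y`.
  hall : ∀ D → ∃[ X ] ∃[ m ] length X + length m ≤ length D × Matching X m ×
    (∀ {a} → a ∈ D → N a ⊆ X ⊎ a ∈ dom m)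
  hall []      = [] , [] , z≤n , mkMatching [] (λ ()) (λ ()) , λ ()
  hall (c ∷ D) with hall D
  ... | X , m , ≤D , M , cover with augment (length m) c ≤-refl M
  ...   | inj₁ A = X , m′
      , ≤-trans (+-monoʳ-≤ (length X) size≤) (≤-trans (≤-reflexive (+-suc (length X) (length m))) (s≤s ≤D))
      , matching
      , λ { (here refl) → inj₂ (covers (here refl)) ; (there a∈) → cover′ a∈ }
    where
    open Augmented A
    cover′ : ∀ {a} → a ∈ D → N a ⊆ X ⊎ a ∈ dom m′
    cover′ a∈ with cover a∈
    ... | inj₁ N⊆X = inj₁ N⊆X
    ... | inj₂ a∈m = inj₂ (covers (there a∈m))
  ...   | inj₂ S = Y , m₂ , ≤-trans size≤ (m≤n⇒m≤1+n ≤D) , matching₂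
      , λ { (here refl) → inj₁ (saturated (here refl)) ; (there a∈) → cover′ a∈ }
    where
    open Saturated S
    cover′ : ∀ {a} → a ∈ D → N a ⊆ Y ⊎ a ∈ dom m₂
    cover′ a∈ with cover a∈
    ... | inj₁ N⊆X = inj₁ (X⊆Y ∘ N⊆X)
    ... | inj₂ a∈m with covers a∈m
    ...   | inj₁ a∈₁ = inj₁ (saturated (there a∈₁))
    ...   | inj₂ a∈₂ = inj₂ a∈₂

-- Adds the same quantity to both sides of an inequality, so that a linear
-- consequence of hypotheses l ≤ r becomes two semiring identities.
linear : ∀ {l r} c {m n} → m + c ≡ l → r ≡ n + c → l ≤ r → m ≤ n
linear c {m} {n} p q l≤r = +-cancelʳ-≤ c m n (≤-trans (≤-reflexive p) (≤-trans l≤r (≤-reflexive q)))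

-- Prefix sums, cut-off vertices and heavy segments

prefix : (ℕ → ℕ) → ℕ → ℕ
prefix f zero    = 0
prefix f (suc n) = prefix f n + f n

prefix-mono : ∀ f {m n} → m ≤ n → prefix f m ≤ prefix f n
prefix-mono f m≤n = go (≤⇒≤′ m≤n)
  where
  go : ∀ {m n} → m ≤′ n → prefix f m ≤ prefix f n
  go ≤′-refl                 = ≤-refl
  go (≤′-step {n = n} m≤n)   = ≤-trans (go m≤n) (m≤m+n (prefix f n) (f n))

prefix-cong-mono : ∀ {f g} → (∀ n → f n ≤ g n) → ∀ n → prefix f n ≤ prefix g n
prefix-cong-mono f≤g zero    = z≤n
prefix-cong-mono f≤g (suc n) = +-mono-≤ (prefix-cong-mono f≤g n) (f≤g n)

-- Finite sets of vertices (j , i) of the grid, by level j.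
Rows : Set
Rows = ℕ → List ℕ

sizes : Rows → ℕ → ℕ
sizes U j = length (U j)

open import Data.List.Membership.DecPropositional _≟ⁿ_ using () renaming (_∈?_ to _∈ⁿ?_)

successors : List ℕ → List ℕ
successors A = filter (λ i → suc i ∈ⁿ? A) A

-- The vertices (j , i) cut off from level 0 by U, where (suc j , i) has the
-- predecessors (j , i) and (j , suc i).
blocked : Rows → Rows
blocked U zero    = U zero
blocked U (suc j) = U (suc j) ++ successors (blocked U j)

-- A nonempty finite `A` is not closed under `suc`, as climbing from `x` would exceed its maximum;
-- so the filter drops at least one element. Hence each level upwards costs a blocked vertex.
successors-length : ∀ A → length (successors A) ≤ pred (length A)
successors-length []        = z≤n
successors-length A@(x ∷ _) with any? (λ i → ¬? (suc i ∈ⁿ? A)) A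
... | yes a = ≤-pred (filter-notAll (λ i → suc i ∈ⁿ? A) A a)
... | no ¬a = ⊥-elim (1+n≰n (≤-trans (m≤n+m _ x) (All.lookup (xs≤max 0 A) (climb (suc (max 0 A))))))
  where
  climb : ∀ k → x + k ∈ A
  climb zero    = subst (_∈ A) (sym (+-identityʳ x)) (here refl)
  climb (suc k) = subst (_∈ A) (sym (+-suc x k))
    (decidable-stable (_ ∈ⁿ? A) (λ ∉A → ¬a (lose (climb k) ∉A)))

blocked-length : ∀ U j → length (blocked U (suc j)) ≤ pred (length (blocked U j)) + sizes U (suc j)
blocked-length U j = begin
  length (U (suc j) ++ successors (blocked U j))          ≡⟨ length-++ (U (suc j)) ⟩
  sizes U (suc j) + length (successors (blocked U j))     ≤⟨ +-monoʳ-≤ (sizes U (suc j)) (successors-length (blocked U j)) ⟩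
  sizes U (suc j) + pred (length (blocked U j))           ≡⟨ +-comm (sizes U (suc j)) _ ⟩
  pred (length (blocked U j)) + sizes U (suc j)           ∎
  where open ≤-Reasoning

⊆-blocked : ∀ U j → U j ⊆ blocked U j
⊆-blocked U zero    i∈ = i∈
⊆-blocked U (suc j) i∈ = ∈-++⁺ˡ i∈

blocked-closed : ∀ U j {i} → i ∈ blocked U j → suc i ∈ blocked U j → i ∈ blocked U (suc j)
blocked-closed U j i∈ si∈ = ∈-++⁺ʳ (U (suc j)) (∈-filter⁺ (λ i → suc i ∈ⁿ? blocked U j) i∈ si∈)

blocked-suc⁻ : ∀ U j {i} → i ∈ blocked U (suc j) → i ∈ U (suc j) ⊎ i ∈ blocked U j × suc i ∈ blocked U j
blocked-suc⁻ U j i∈ with ∈-++⁻ (U (suc j)) i∈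
... | inj₁ i∈U = inj₁ i∈U
... | inj₂ i∈s = inj₂ (∈-filter⁻ (λ i → suc i ∈ⁿ? blocked U j) i∈s)

blocked-mono : ∀ {U W} → (∀ j → U j ⊆ W j) → ∀ j → blocked U j ⊆ blocked W j
blocked-mono         U⊆W zero    i∈ = U⊆W zero i∈
blocked-mono {U} {W} U⊆W (suc j) i∈ with blocked-suc⁻ U j i∈
... | inj₁ i∈U        = ⊆-blocked W (suc j) (U⊆W (suc j) i∈U)
... | inj₂ (i∈ , si∈) = blocked-closed W j (blocked-mono U⊆W j i∈) (blocked-mono U⊆W j si∈)

-- At most (K ∸ j) / 3 vertices are at levels j to K, with both sides moved to
-- avoid the subtraction.
Low : ℕ → (ℕ → ℕ) → Set
Low K u = ∀ {j} → j ≤ K → j + 3 * prefix u K ≤ K + 3 * prefix u j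

-- With u and x for the sums over the levels from `a` up to but excluding `b`, `heavy` reads 2x < u
-- and `short` reads b - a ≤ u + x, both freed from subtraction. Level `b` itself is not cut off at
-- all.
record Segment (K : ℕ) (u x c : ℕ → ℕ) : Set where
  field
    a b     : ℕ
    a≤b     : a ≤ b
    b≤K     : b ≤ K
    c[b]≡0  : c b ≡ 0
    heavy   : prefix u a + 2 * prefix x b < prefix u b + 2 * prefix x a
    short   : b + prefix u a + prefix x a ≤ a + prefix u b + prefix x b

module _ {K : ℕ} {u x c : ℕ → ℕ} (low : Low K u)
  (c₀ : c 0 ≤ u 0 + x 0) (cₛ : ∀ j → c (suc j) ≤ pred (c j) + (u (suc j) + x (suc j)))
  (u≤c : ∀ j → u j ≤ c j) (x≤c : ∀ j → x j ≤ c j) where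

  -- All levels of [a , j) have c > 0, and r bounds what they leave for level j.
  scan : ∀ k j a r → j + k ≡ K → a ≤ j → prefix u a ≤ 2 * prefix x a →
    c j ≤ r + (u j + x j) →
    r + j + prefix u a + prefix x a ≤ a + prefix u j + prefix x j →
    Segment K u x c ⊎ prefix u K ≤ 2 * prefix x K
  -- The last segment may reach `K` without meeting a free level. With u and x for its sums, `low`
  -- gives 3u ≤ K - a and the invariant gives K - a ≤ u + x, so 2u ≤ x; twice `done` takes care of
  -- the levels below `a`.
  scan zero j a r j+0≡K a≤j done cⱼ open′ = inj₂ (*-cancelˡ-≤ 2 (begin
    2 * prefix u K                      ≤⟨ linear _ (id₁ K a (prefix u K) (prefix u a) (prefix x a) (prefix x K)) (id₂ K a (prefix u K) (prefix u a) (prefix x a) (prefix x K)) (+-mono-≤ (+-mono-≤ (low a≤K) open″) (*-monoʳ-≤ 2 done)) ⟩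
    3 * prefix x a + prefix x K         ≤⟨ +-monoˡ-≤ (prefix x K) (*-monoʳ-≤ 3 (prefix-mono x a≤K)) ⟩
    3 * prefix x K + prefix x K         ≡⟨ id₃ (prefix x K) ⟩
    2 * (2 * prefix x K)                ∎))
    where
    open ≤-Reasoning
    j≡K : j ≡ K
    j≡K = trans (sym (+-identityʳ j)) j+0≡K
    a≤K : a ≤ K
    a≤K = subst (a ≤_) j≡K a≤j
    open″ : K + prefix u a + prefix x a ≤ a + prefix u K + prefix x K
    open″ = subst (λ j → j + prefix u a + prefix x a ≤ a + prefix u j + prefix x j) j≡K
      (≤-trans (+-monoˡ-≤ (prefix x a) (+-monoˡ-≤ (prefix u a) (m≤n+m j r))) open′)
    id₁ : ∀ K a U V W Z → 2 * U + (a + U + K + V + W + 2 * V) ≡ a + 3 * U + (K + V + W) + 2 * V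
    id₁ = solve-∀
    id₂ : ∀ K a U V W Z → K + 3 * V + (a + U + Z) + 2 * (2 * W) ≡ 3 * W + Z + (a + U + K + V + W + 2 * V)
    id₂ = solve-∀
    id₃ : ∀ Z → 3 * Z + Z ≡ 2 * (2 * Z)
    id₃ = solve-∀
  scan (suc k) j a r j+k≡K a≤j done cⱼ open′ with c j in cⱼ≡
  -- One blocked vertex is lost in passing to the next level, and it pays for level `j`.
  ... | suc r′ = scan k (suc j) a r′ (trans (sym (+-suc j k)) j+k≡K) (m≤n⇒m≤1+n a≤j) done
    (subst (λ n → c (suc j) ≤ pred n + _) cⱼ≡ (cₛ j))
    (linear _ (id₁ r r′ j a (u j) (x j) (prefix u j) (prefix u a) (prefix x a) (prefix x j))
      (id₂ r r′ j a (u j) (x j) (prefix u j) (prefix u a) (prefix x a) (prefix x j)) (+-mono-≤ cⱼ open′))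
    where
    id₁ : ∀ r r′ j a p q U V W Z → r′ + suc j + V + W + r ≡ suc r′ + (r + j + V + W)
    id₁ = solve-∀
    id₂ : ∀ r r′ j a p q U V W Z → r + (p + q) + (a + U + Z) ≡ a + (U + p) + (Z + q) + r
    id₂ = solve-∀
  ... | zero with prefix u a + 2 * prefix x j <? prefix u j + 2 * prefix x a
  ...   | yes heavy = inj₁ record
    { a = a ; b = j ; a≤b = a≤j ; b≤K = subst (j ≤_) j+k≡K (m≤m+n j (suc k)) ; c[b]≡0 = cⱼ≡
    ; heavy = heavy
    ; short = ≤-trans (+-monoˡ-≤ (prefix x a) (+-monoˡ-≤ (prefix u a) (m≤n+m j r))) open′ }
  -- As level `j` is free, `u` and `x` vanish there. The light segment joins the finished part, and
  -- a new one starts at `suc j` with nothing left over.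
  ...   | no light = scan k (suc j) (suc j) 0 (trans (sym (+-suc j k)) j+k≡K) ≤-refl
    (subst₂ (λ p q → p ≤ 2 * q) (constant u u≤c) (constant x x≤c)
      (linear _ (id₁ (prefix u j) (prefix u a) (prefix x a)) (id₂ (prefix u a) (prefix x a) (prefix x j))
        (+-mono-≤ (≮⇒≥ light) done)))
    (subst (λ n → c (suc j) ≤ pred n + _) cⱼ≡ (cₛ j))
    ≤-refl
    where
    constant : ∀ f → (∀ j → f j ≤ c j) → prefix f j ≡ prefix f (suc j)
    constant f f≤c = sym (trans (cong (prefix f j +_) (n≤0⇒n≡0 (subst (f j ≤_) cⱼ≡ (f≤c j)))) (+-identityʳ _))
    id₁ : ∀ U V W → U + (2 * W + V) ≡ U + 2 * W + V
    id₁ = solve-∀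
    id₂ : ∀ V W Z → V + 2 * Z + 2 * W ≡ 2 * Z + (2 * W + V)
    id₂ = solve-∀

  segment : Segment K u x c ⊎ prefix u K ≤ 2 * prefix x K
  segment = scan K 0 0 0 refl z≤n z≤n c₀ ≤-refl

-- Replacing a segment of levels

module Swap {A : Set} (U X : ℕ → A) (a b : ℕ) where

  swap : ℕ → A
  swap j with a ≤? j ×-dec j <? b
  ... | yes _ = X j
  ... | no  _ = U j

  swap-in : ∀ {j} → a ≤ j → j < b → swap j ≡ X j
  swap-in {j} a≤j j<b with a ≤? j ×-dec j <? b
  ... | yes _ = refl
  ... | no ¬p = ⊥-elim (¬p (a≤j , j<b))

  swap-out : ∀ {j} → ¬ (a ≤ j × j < b) → swap j ≡ U j
  swap-out {j} ¬p with a ≤? j ×-dec j <? b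
  ... | yes p = ⊥-elim (¬p p)
  ... | no  _ = refl

module _ (u x : ℕ → ℕ) {a b : ℕ} (a≤b : a ≤ b) where

  open Swap u x a b

  prefix-swap-below : ∀ {j} → j ≤ a → prefix swap j ≡ prefix u j
  prefix-swap-below {zero}  _   = refl
  prefix-swap-below {suc j} j<a = cong₂ _+_ (prefix-swap-below (<⇒≤ j<a))
    (swap-out λ (a≤j , _) → <⇒≱ j<a a≤j)

  prefix-swap-in : ∀ {j} → a ≤′ j → j ≤ b → prefix swap j + prefix x a ≡ prefix u a + prefix x j
  prefix-swap-in ≤′-refl _ = cong (_+ prefix x a) (prefix-swap-below ≤-refl)
  prefix-swap-in (≤′-step {n = j} a≤j) j<b = begin
    prefix swap j + swap j + prefix x a   ≡⟨ cong (λ n → prefix swap j + n + prefix x a) (swap-in (≤′⇒≤ a≤j) j<b) ⟩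
    prefix swap j + x j + prefix x a      ≡⟨ id₁ (prefix swap j) (x j) (prefix x a) ⟩
    prefix swap j + prefix x a + x j      ≡⟨ cong (_+ x j) (prefix-swap-in a≤j (<⇒≤ j<b)) ⟩
    prefix u a + prefix x j + x j         ≡⟨ +-assoc (prefix u a) (prefix x j) (x j) ⟩
    prefix u a + (prefix x j + x j)       ∎
    where
    open ≡-Reasoning
    id₁ : ∀ p q r → p + q + r ≡ p + r + q
    id₁ = solve-∀

  prefix-swap-above : ∀ {j} → b ≤′ j →
    prefix swap j + (prefix u b + prefix x a) ≡ prefix u j + (prefix u a + prefix x b)
  prefix-swap-above ≤′-refl = begin
    prefix swap b + (prefix u b + prefix x a)  ≡⟨ id₁ (prefix swap b) (prefix u b) (prefix x a) ⟩
    prefix u b + (prefix swap b + prefix x a)  ≡⟨ cong (prefix u b +_) (prefix-swap-in (≤⇒≤′ a≤b) ≤-refl) ⟩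
    prefix u b + (prefix u a + prefix x b)     ∎
    where
    open ≡-Reasoning
    id₁ : ∀ p q r → p + (q + r) ≡ q + (p + r)
    id₁ = solve-∀
  prefix-swap-above (≤′-step {n = j} b≤j) = begin
    prefix swap j + swap j + c₁      ≡⟨ cong (λ n → prefix swap j + n + c₁) (swap-out λ (_ , j<b) → <⇒≱ j<b (≤′⇒≤ b≤j)) ⟩
    prefix swap j + u j + c₁         ≡⟨ id₁ (prefix swap j) (u j) c₁ ⟩
    prefix swap j + c₁ + u j         ≡⟨ cong (_+ u j) (prefix-swap-above b≤j) ⟩
    prefix u j + c₂ + u j            ≡⟨ id₁ (prefix u j) c₂ (u j) ⟩
    prefix u j + u j + c₂            ∎
    where
    open ≡-Reasoning
    c₁ c₂ : ℕ
    c₁ = prefix u b + prefix x a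
    c₂ = prefix u a + prefix x b
    id₁ : ∀ p q r → p + q + r ≡ p + r + q
    id₁ = solve-∀

-- For a level `j` between `a` and `b`. The letters are prefix sums: `S`, `Sⱼ` after the swap, `U`,
-- `A`, `B` of the old sizes at `K`, `a`, `b`, and `X`, `Xⱼ`, `Y` of the replacement at `a`, `j`,
-- `b`. Let u = B - A and x = Y - X. From `j` on there remain at most x vertices and the old ones
-- from `b` on, so by the bound at `a` it is enough that 3x - 3u + (j - a) ≤ 0; this follows from j
-- - a ≤ u + x and 2x ≤ u.
low-inside : ∀ S Sⱼ U A B X Xⱼ Y K j a b → S + (B + X) ≡ U + (A + Y) → Sⱼ + X ≡ A + Xⱼ →
  j + (b + A + X) + (a + 3 * U) + 2 * (A + 2 * Y) + 3 * X ≤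
    b + (a + B + Y) + (K + 3 * A) + 2 * (B + 2 * X) + 3 * Xⱼ →
  j + 3 * S ≤ K + 3 * Sⱼ
low-inside S Sⱼ U A B X Xⱼ Y K j a b p q = linear (3 * (B + X) + 3 * X + (a + b + Y + X))
  (trans (id₁ j S (B + X) X a b Y) (trans (cong (λ n → j + 3 * n + 3 * X + (a + b + Y + X)) p) (id₂ j U A Y X a b)))
  (trans (id₃ b a B Y K A X Xⱼ) (trans (cong (λ n → K + 3 * n + 3 * (B + X) + (a + b + Y + X)) (sym q)) (id₄ K Sⱼ X B a b Y)))
  where
  id₁ : ∀ j S C X a b Y → j + 3 * S + (3 * C + 3 * X + (a + b + Y + X)) ≡ j + 3 * (S + C) + 3 * X + (a + b + Y + X)
  id₁ = solve-∀
  id₂ : ∀ j U A Y X a b → j + 3 * (U + (A + Y)) + 3 * X + (a + b + Y + X) ≡ j + (b + A + X) + (a + 3 * U) + 2 * (A + 2 * Y) + 3 * X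
  id₂ = solve-∀
  id₃ : ∀ b a B Y K A X Xⱼ → b + (a + B + Y) + (K + 3 * A) + 2 * (B + 2 * X) + 3 * Xⱼ ≡ K + 3 * (A + Xⱼ) + 3 * (B + X) + (a + b + Y + X)
  id₃ = solve-∀
  id₄ : ∀ K S X B a b Y → K + 3 * (S + X) + 3 * (B + X) + (a + b + Y + X) ≡ K + 3 * S + (3 * (B + X) + 3 * X + (a + b + Y + X))
  id₄ = solve-∀

low-above : ∀ S Sⱼ U Uⱼ A B X Y K j → S + (B + X) ≡ U + (A + Y) → Sⱼ + (B + X) ≡ Uⱼ + (A + Y) →
  j + 3 * U ≤ K + 3 * Uⱼ → j + 3 * S ≤ K + 3 * Sⱼ
low-above S Sⱼ U Uⱼ A B X Y K j p q h = linear (3 * (B + X))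
  (trans (id₁ j S (B + X)) (trans (cong (λ n → j + 3 * n) p) (sym (id₁ j U (A + Y)))))
  (trans (id₁ K Uⱼ (A + Y)) (trans (cong (λ n → K + 3 * n) (sym q)) (sym (id₁ K Sⱼ (B + X)))))
  (+-monoˡ-≤ (3 * (A + Y)) h)
  where
  id₁ : ∀ j S C → j + 3 * S + 3 * C ≡ j + 3 * (S + C)
  id₁ = solve-∀

module _ {K : ℕ} {u x c : ℕ → ℕ} (low : Low K u) (s : Segment K u x c) where

  open Segment s
  open Swap u x a b

  private
    x-mono : prefix x a ≤ prefix x b
    x-mono = prefix-mono x a≤b

  swap-lighter : prefix swap K < prefix u K
  swap-lighter = linear (prefix u b + 2 * prefix x a)
    (trans (id₁ (prefix swap K) (prefix u b) (prefix x a))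
      (cong (λ n → suc (n + prefix x a)) (prefix-swap-above u x a≤b (≤⇒≤′ b≤K))))
    refl
    (begin
      suc (prefix u K + (prefix u a + prefix x b) + prefix x a)         ≡⟨ id₃ (prefix u K) (prefix u a) (prefix x b) (prefix x a) ⟩
      prefix u K + (suc (prefix u a + prefix x b) + prefix x a)         ≤⟨ +-monoʳ-≤ (prefix u K) (+-monoʳ-≤ (suc (prefix u a + prefix x b)) x-mono) ⟩
      prefix u K + (suc (prefix u a + prefix x b) + prefix x b)         ≡⟨ cong (prefix u K +_) (id₄ (prefix u a) (prefix x b)) ⟩
      prefix u K + suc (prefix u a + 2 * prefix x b)                    ≤⟨ +-monoʳ-≤ (prefix u K) heavy ⟩
      prefix u K + (prefix u b + 2 * prefix x a)                        ∎)
    where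
    open ≤-Reasoning
    id₁ : ∀ S B X → suc S + (B + 2 * X) ≡ suc (S + (B + X) + X)
    id₁ = solve-∀
    id₃ : ∀ U A Y X → suc (U + (A + Y) + X) ≡ U + (suc (A + Y) + X)
    id₃ = solve-∀
    id₄ : ∀ A Y → suc (A + Y) + Y ≡ suc (A + 2 * Y)
    id₄ = solve-∀

  low-swap : Low K swap
  low-swap {j} j≤K with j ≤? a
  ... | yes j≤a = begin
    j + 3 * prefix swap K  ≤⟨ +-monoʳ-≤ j (*-monoʳ-≤ 3 (<⇒≤ swap-lighter)) ⟩
    j + 3 * prefix u K     ≤⟨ low j≤K ⟩
    K + 3 * prefix u j     ≡⟨ cong (λ n → K + 3 * n) (prefix-swap-below u x a≤b j≤a) ⟨
    K + 3 * prefix swap j  ∎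
    where open ≤-Reasoning
  ... | no j≰a with j ≤? b
  ...   | yes j≤b = low-inside (prefix swap K) (prefix swap j) (prefix u K) (prefix u a) (prefix u b)
    (prefix x a) (prefix x j) (prefix x b) K j a b
    (prefix-swap-above u x a≤b (≤⇒≤′ b≤K))
    (prefix-swap-in u x a≤b (≤⇒≤′ (<⇒≤ (≰⇒> j≰a))) j≤b)
    (+-mono-≤ (+-mono-≤ (+-mono-≤ (+-mono-≤ j≤b short) (low (≤-trans a≤b b≤K)))
      (*-monoʳ-≤ 2 (<⇒≤ heavy))) (*-monoʳ-≤ 3 (prefix-mono x (<⇒≤ (≰⇒> j≰a)))))
  ...   | no j≰b = low-above (prefix swap K) (prefix swap j) (prefix u K) (prefix u j) (prefix u a) (prefix u b)
    (prefix x a) (prefix x b) K j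
    (prefix-swap-above u x a≤b (≤⇒≤′ b≤K))
    (prefix-swap-above u x a≤b (≤⇒≤′ (<⇒≤ (≰⇒> j≰b)))) (low j≤K)

-- Models and the transfer between vertex sets

-- Models of the pebbling axioms above level 0, in which the sink (H , 0) is false.
record Model (H : ℕ) (h : ℕ → ℕ → Bool) : Set where
  field
    closed : ∀ {j i} → h j i ≡ true → h j (suc i) ≡ true → h (suc j) i ≡ true
    sink   : h H 0 ≡ false

_⊩_ : (ℕ → ℕ → Bool) → Rows → Set
h ⊩ U = ∀ j {i} → i ∈ U j → h j i ≡ true

-- What the truth of `U` guarantees about the vertices in `X` can then be had from `U′` as well:
-- `h′` is traded for a model that makes `U` true and looks the same on `X`.
Transfer : ℕ → Rows → Rows → Rows → Set
Transfer H X U U′ = ∀ h′ → Model H h′ → h′ ⊩ U′ →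
  ∃[ h ] Model H h × h ⊩ U × (∀ j {i} → i ∈ X j → h j i ≡ h′ j i)

_∪_ : Rows → Rows → Rows
(U ∪ W) j = U j ++ W j

≡true-ext : ∀ {a b} → (a ≡ true → b ≡ true) → (b ≡ true → a ≡ true) → a ≡ b
≡true-ext {false} {false} f g = refl
≡true-ext {false} {true}  f g = g refl
≡true-ext {true}          f g = sym (f refl)

module _ {H : ℕ} {X U : Rows} {a b : ℕ} (b≤H : b ≤ H) (free : blocked (U ∪ X) b ≡ []) where

  open Swap U X a b

  -- Let `h` be the closure of `U` together with the vertices of `X` true in `h′`. As level `b` is
  -- free, nothing inside the segment leads to anything above it, so outside the segment whatever
  -- `h` makes true is true in `h′`; this covers the sink, since `b ≤ H`. Inside, `h′` makes all of
  -- `X` true because the swap has put `X` there.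
  transfer-swap : Transfer H X U swap
  transfer-swap h′ M′ h′⊩ = h
    , record { closed = closed ; sink = sink }
    , (λ j i∈ → ∈⇒h j (⊆-blocked W j (∈-++⁺ˡ i∈)))
    , λ j i∈ → ≡true-ext (h⇒h′ j i∈) (λ h′≡ → ∈⇒h j (⊆-blocked W j (∈-++⁺ʳ (U j) (∈-filter⁺ (λ i → h′ j i Bool.≟ true) i∈ h′≡))))
    where
    T W : Rows
    T j = filter (λ i → h′ j i Bool.≟ true) (X j)
    W = U ∪ T

    h : ℕ → ℕ → Bool
    h j i = does (i ∈ⁿ? blocked W j)

    ∈⇒h : ∀ j {i} → i ∈ blocked W j → h j i ≡ true
    ∈⇒h j {i} = dec-true (i ∈ⁿ? blocked W j)

    h⇒∈ : ∀ j {i} → h j i ≡ true → i ∈ blocked W j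
    h⇒∈ j {i} h≡ with i ∈ⁿ? blocked W j
    ... | yes i∈ = i∈
    h⇒∈ j () | no _

    closed : ∀ {j i} → h j i ≡ true → h j (suc i) ≡ true → h (suc j) i ≡ true
    closed {j} p q = ∈⇒h (suc j) (blocked-closed W j (h⇒∈ j p) (h⇒∈ j q))

    W⊆ : ∀ j → W j ⊆ (U ∪ X) j
    W⊆ j i∈ with ∈-++⁻ (U j) i∈
    ... | inj₁ i∈U = ∈-++⁺ˡ i∈U
    ... | inj₂ i∈T = ∈-++⁺ʳ (U j) (proj₁ (∈-filter⁻ (λ i → h′ j i Bool.≟ true) i∈T))

    free′ : ∀ {i} → i ∉ blocked W b
    free′ i∈ with subst (_ ∈_) free (blocked-mono W⊆ b i∈)
    ... | ()

    in-W : ∀ j {i} → ¬ (a ≤ j × j < b) → i ∈ W j → h′ j i ≡ true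
    in-W j {i} outside i∈ with ∈-++⁻ (U j) i∈
    ... | inj₁ i∈U = h′⊩ j (subst (i ∈_) (sym (swap-out outside)) i∈U)
    ... | inj₂ i∈T = proj₂ (∈-filter⁻ (λ i → h′ j i Bool.≟ true) {xs = X j} i∈T)

    -- No path into a vertex above the segment starts inside it, as level b is free.
    outside⇒h′ : ∀ j {i} → ¬ (a ≤ j × j < b) → i ∈ blocked W j → h′ j i ≡ true
    outside⇒h′ zero    outside i∈ = in-W 0 outside i∈
    outside⇒h′ (suc j) outside i∈ with blocked-suc⁻ W j i∈
    ... | inj₁ i∈W = in-W (suc j) outside i∈W
    ... | inj₂ (i∈ⱼ , si∈ⱼ) with a ≤? j ×-dec j <? b
    ...   | no outsideⱼ = Model.closed M′ (outside⇒h′ j outsideⱼ i∈ⱼ) (outside⇒h′ j outsideⱼ si∈ⱼ)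
    ...   | yes (a≤j , j<b) with m≤n⇒m<n∨m≡n j<b
    ...     | inj₁ sj<b = ⊥-elim (outside (m≤n⇒m≤1+n a≤j , sj<b))
    ...     | inj₂ refl = ⊥-elim (free′ i∈)

    sink : h H 0 ≡ false
    sink with h H 0 in eq
    ... | false = refl
    ... | true  = contradiction (trans (sym (outside⇒h′ H (λ (_ , H<b) → <⇒≱ H<b b≤H) (h⇒∈ H eq))) (Model.sink M′)) λ ()

    h⇒h′ : ∀ j {i} → i ∈ X j → h j i ≡ true → h′ j i ≡ true
    h⇒h′ j {i} i∈X h≡ with a ≤? j ×-dec j <? b
    ... | yes (a≤j , j<b) = h′⊩ j (subst (i ∈_) (sym (swap-in a≤j j<b)) i∈X)
    ... | no outside      = outside⇒h′ j outside (h⇒∈ j h≡)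

transfer-refl : ∀ {H X U} → Transfer H X U U
transfer-refl h M h⊩ = h , M , h⊩ , λ _ _ → refl

transfer-trans : ∀ {H X U U′ U″} → Transfer H X U U′ → Transfer H X U′ U″ → Transfer H X U U″
transfer-trans t t′ h″ M h⊩ with t′ h″ M h⊩
... | h′ , M′ , h′⊩ , eq′ with t h′ M′ h′⊩
... | h , M₀ , h⊩₀ , eq = h , M₀ , h⊩₀ , λ j i∈ → trans (eq j i∈) (eq′ j i∈)

map-swap : ∀ {A B : Set} (f : A → B) U X a b j → f (Swap.swap U X a b j) ≡ Swap.swap (f ∘ U) (f ∘ X) a b j
map-swap f U X a b j with a ≤? j ×-dec j <? b
... | yes _ = refl
... | no  _ = refl

prefix-cong : ∀ {f g} → (∀ n → f n ≡ g n) → ∀ n → prefix f n ≡ prefix g n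
prefix-cong f≗g zero    = refl
prefix-cong f≗g (suc n) = cong₂ _+_ (prefix-cong f≗g n) (f≗g n)

length≡0 : ∀ {A : Set} {xs : List A} → length xs ≡ 0 → xs ≡ []
length≡0 {xs = []} _ = refl

-- Swapping a heavy segment strictly lowers the total below `K`, which serves as fuel. When no such
-- segment is left, the total is at most twice that of `X`. Segments end at or below `K`, so levels
-- from `K` on keep their vertices.
compress : ∀ {H K} X U → K ≤ H → Low K (sizes U) → 
  ∃[ U′ ] Low K (sizes U′) × prefix (sizes U′) K ≤ 2 * prefix (sizes X) K ×
    (∀ j → K ≤ j → U′ j ≡ U j) × Transfer H X U U′
compress {H} {K} X U K≤H low = go _ U low ≤-refl
  where
  go : ∀ n U → Low K (sizes U) → prefix (sizes U) K ≤ n →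
    ∃[ U′ ] Low K (sizes U′) × prefix (sizes U′) K ≤ 2 * prefix (sizes X) K ×
    (∀ j → K ≤ j → U′ j ≡ U j) × Transfer H X U U′
  go n U low U≤n with segment {c = λ j → length (blocked (U ∪ X) j)} low
      (≤-reflexive (length-++ (U 0)))
      (λ j → ≤-trans (blocked-length (U ∪ X) j) (+-monoʳ-≤ _ (≤-reflexive (length-++ (U (suc j))))))
      (λ j → ≤-trans (≤-trans (m≤m+n _ _) (≤-reflexive (sym (length-++ (U j))))) (blocked-≥ j))
      (λ j → ≤-trans (≤-trans (m≤n+m _ (sizes U j)) (≤-reflexive (sym (length-++ (U j))))) (blocked-≥ j))
    where
    blocked-≥ : ∀ j → length ((U ∪ X) j) ≤ length (blocked (U ∪ X) j)
    blocked-≥ zero    = ≤-refl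
    blocked-≥ (suc j) = ≤-trans (m≤m+n _ _) (≤-reflexive (sym (length-++ ((U ∪ X) (suc j)))))
  ... | inj₂ small = U , low , small , (λ _ _ → refl) , transfer-refl {H} {X} {U}
  ... | inj₁ s with n
  ...   | zero  = contradiction (≤-trans (swap-lighter low s) U≤n) λ ()
  ...   | suc n =
    let open Segment s
        sizes-swap = map-swap length U X a b
        U′ , low′ , small , same , t = go n (Swap.swap U X a b)
          (λ {j} j≤K → subst₂ (λ p q → j + 3 * p ≤ K + 3 * q)
            (sym (prefix-cong sizes-swap K)) (sym (prefix-cong sizes-swap j)) (low-swap low s j≤K))
          (≤-pred (≤-trans (s≤s (≤-reflexive (prefix-cong sizes-swap K))) (≤-trans (swap-lighter low s) U≤n)))
    in U′ , low′ , small
      , (λ j K≤j → trans (same j K≤j) (Swap.swap-out U X a b λ (_ , j<b) → <⇒≱ (≤-trans j<b b≤K) K≤j))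
      , transfer-trans {H} {X} {U} (transfer-swap {X = X} {U} {a} {b} (≤-trans b≤K K≤H) (length≡0 c[b]≡0)) t

-- Renaming of variables

-- Literals sent to the same variable overwrite each other, whence `lookup-rename` asks for
-- injectivity.
rename : ∀ {m v} → (Fin m → Fin v) → Clause m → Clause v
rename σ []           = 𝟘
rename σ (nothing ∷ C) = rename (σ ∘ suc) C
rename σ (just b ∷ C)  = rename (σ ∘ suc) C [ σ zero ]≔ just b

lookup-𝟘 : ∀ {v} (y : Fin v) → lookup 𝟘 y ≡ nothing
lookup-𝟘 y = Vec.lookup-replicate y nothing

lookup-rename⁻ : ∀ {m v} (σ : Fin m → Fin v) C {y b} → lookup (rename σ C) y ≡ just b →
  ∃[ x ] y ≡ σ x × lookup C x ≡ just b
lookup-rename⁻ σ [] {y} eq = contradiction (trans (sym (lookup-𝟘 y)) eq) λ ()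
lookup-rename⁻ σ (nothing ∷ C) eq =
  let x , y≡ , Cx = lookup-rename⁻ (σ ∘ suc) C eq in suc x , y≡ , Cx
lookup-rename⁻ σ (just b ∷ C) {y} eq with y Fin.≟ σ zero
... | yes refl = zero , refl , trans (sym (Vec.lookup∘updateAt (σ zero) (rename (σ ∘ suc) C))) eq
... | no  y≢   =
  let x , y≡ , Cx = lookup-rename⁻ (σ ∘ suc) C
        (trans (sym (Vec.lookup∘updateAt′ y (σ zero) y≢ (rename (σ ∘ suc) C))) eq)
  in suc x , y≡ , Cx

lookup-rename-outside : ∀ {m v} (σ : Fin m → Fin v) C {y} → (∀ x → y ≢ σ x) → lookup (rename σ C) y ≡ nothing
lookup-rename-outside σ C {y} y∉ with lookup (rename σ C) y in eq
... | nothing = refl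
... | just b  = let x , y≡ , _ = lookup-rename⁻ σ C eq in ⊥-elim (y∉ x y≡)

lookup-rename : ∀ {m v} {σ : Fin m → Fin v} → Injective _≡_ _≡_ σ → ∀ C x → lookup (rename σ C) (σ x) ≡ lookup C x
lookup-rename {σ = σ} inj (nothing ∷ C) zero    = lookup-rename-outside (σ ∘ suc) C λ x eq → case inj eq of λ ()
lookup-rename {σ = σ} inj (nothing ∷ C) (suc x) = lookup-rename (Fin.suc-injective ∘ inj) C x
lookup-rename {σ = σ} inj (just b ∷ C)  zero    = Vec.lookup∘updateAt (σ zero) (rename (σ ∘ suc) C)
lookup-rename {σ = σ} inj (just b ∷ C)  (suc x) = trans
  (Vec.lookup∘updateAt′ (σ (suc x)) (σ zero) (λ eq → case inj eq of λ ()) (rename (σ ∘ suc) C))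
  (lookup-rename (Fin.suc-injective ∘ inj) C x)

⊨-rename : ∀ {m v} {σ : Fin m → Fin v} {α : Fin v → Bool} → Injective _≡_ _≡_ σ → ∀ C → (α ∘ σ) ⊨ C → α ⊨ rename σ C
⊨-rename {σ = σ} inj C (x , Cx) = σ x , trans (lookup-rename inj C x) Cx

⊨-cong : ∀ {v} {α β : Fin v → Bool} {C} → (∀ x → α x ≡ β x) → α ⊨ C → β ⊨ C
⊨-cong eq (x , Cx) = x , trans Cx (cong just (eq x))

⊨-resolvent : ∀ {v} {α : Fin v → Bool} {P Q R} → IsResolvent P Q R → α ⊨ P → α ⊨ Q → α ⊨ R
⊨-resolvent {α = α} {P} {Q} {R} r (y , Py) (z , Qz) = go (y Fin.≟ x) (z Fin.≟ x)
  where
  open IsResolvent r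
  go : Dec (y ≡ x) → Dec (z ≡ x) → α ⊨ R
  go (no y≢x) _ = y , Equivalence.from (R≡B∨C (y , α y))
    (inj₁ (trans (sym (Vec.lookup∘updateAt′ y x y≢x B)) (trans (cong (λ D → lookup D y) (sym P≡B∨x)) Py)))
  go (yes _) (no z≢x) = z , Equivalence.from (R≡B∨C (z , α z))
    (inj₂ (trans (sym (Vec.lookup∘updateAt′ z x z≢x C)) (trans (cong (λ D → lookup D z) (sym Q≡C∨¬x)) Qz)))
  go (yes refl) (yes refl) = contradiction (trans (sym true≡) false≡) λ ()
    where
    true≡ : α x ≡ true
    true≡ = Maybe.just-injective (trans (sym Py) (trans (cong (λ D → lookup D x) P≡B∨x) (Vec.lookup∘updateAt x B)))
    false≡ : α x ≡ false
    false≡ = Maybe.just-injective (trans (sym Qz) (trans (cong (λ D → lookup D x) Q≡C∨¬x) (Vec.lookup∘updateAt x C)))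

-- Blocks of four variables w₁ w₂ z₁ z₂.  A vertex is true when w₁ ≠ w₂; a true
-- left predecessor forces (w₁ ∨ z₁)(¬w₁ ∨ z₂), a true right predecessor
-- (w₂ ∨ ¬z₁)(¬w₂ ∨ ¬z₂), and both together imply w₁ ≠ w₂.

Block : Set
Block = Vec Bool 4

value onLeft onRight : Block → Bool
value   (w₁ ∷ w₂ ∷ _)           = w₁ xor w₂
onLeft  (w₁ ∷ w₂ ∷ z₁ ∷ z₂ ∷ []) = (w₁ ∨ z₁) ∧ (not w₁ ∨ z₂)
onRight (w₁ ∷ w₂ ∷ z₁ ∷ z₂ ∷ []) = (w₂ ∨ not z₁) ∧ (not w₂ ∨ not z₂)

record Obeys (val left right : Bool) (B : Block) : Set where
  constructor obeys
  field
    value≡ : value B ≡ val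
    left⇒  : left ≡ true → onLeft B ≡ true
    right⇒ : right ≡ true → onRight B ≡ true

-- No single literal restricts the value of a block, whence clauses can be
-- satisfied in blocks of their own without constraining the vertices.
fill : ∀ val left right (r : Fin 4) b → (left ≡ true → right ≡ true → val ≡ true) →
  ∃[ B ] Obeys val left right B × lookup B r ≡ b
-- For both values of `p` the block with w₁ = z₂ = `p` and w₂ = z₁ = `not p` meets both constraints,
-- and the two blocks differ at every slot.
fill true _ _ k b _ = twin (p k) , both (p k) , hit k
  where
  twin : Bool → Block
  twin p = p ∷ not p ∷ not p ∷ p ∷ []
  p : Fin 4 → Bool
  p 0F = b
  p 1F = not b
  p 2F = not b
  p 3F = b
  both : ∀ p → Obeys true _ _ (twin p)
  both false = obeys refl (λ _ → refl) (λ _ → refl)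
  both true  = obeys refl (λ _ → refl) (λ _ → refl)
  hit : ∀ k → lookup (twin (p k)) k ≡ b
  hit 0F = refl
  hit 1F = Bool.not-involutive b
  hit 2F = Bool.not-involutive b
  hit 3F = refl
fill false true true k b both = contradiction (both refl refl) λ ()
-- With z₁ and z₂ true, the left constraint holds for either value of w₁ = w₂. Conversely w₁ = w₂
-- can be chosen to satisfy one of its two clauses, which frees the z of that clause.
fill false left false k b _ = witness k
  where
  only : ∀ B → value B ≡ false → onLeft B ≡ true → Obeys false left false B
  only _ v l = obeys v (λ _ → l) λ ()
  same : ∀ b → Obeys false left false (b ∷ b ∷ true ∷ true ∷ [])
  same false = only _ refl refl
  same true  = only _ refl refl
  witness : ∀ k → ∃[ B ] Obeys false left false B × lookup B k ≡ b
  witness 0F = _ , same b , refl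
  witness 1F = _ , same b , refl
  witness 2F = _ , only (true ∷ true ∷ b ∷ true ∷ []) refl refl , refl
  witness 3F = _ , only (false ∷ false ∷ true ∷ b ∷ []) refl refl , refl
fill false false true k b _ = witness k
  where
  only : ∀ B → value B ≡ false → onRight B ≡ true → Obeys false false true B
  only _ v r = obeys v (λ ()) λ _ → r
  same : ∀ b → Obeys false false true (b ∷ b ∷ false ∷ false ∷ [])
  same false = only _ refl refl
  same true  = only _ refl refl
  witness : ∀ k → ∃[ B ] Obeys false false true B × lookup B k ≡ b
  witness 0F = _ , same b , refl
  witness 1F = _ , same b , refl
  witness 2F = _ , only (true ∷ true ∷ b ∷ false ∷ []) refl refl , refl
  witness 3F = _ , only (false ∷ false ∷ false ∷ b ∷ []) refl refl , refl

-- The formula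

clause : ∀ {v} → List (Literal v) → Clause v
clause = foldr (λ (x , b) C → C [ x ]≔ just b) 𝟘

pattern pos x = x , true
pattern neg x = x , false

oddClauses evenClauses : List (Clause 4)
oddClauses  = clause (pos 0F ∷ pos 1F ∷ []) ∷ clause (neg 0F ∷ neg 1F ∷ []) ∷ []
evenClauses = clause (pos 0F ∷ neg 1F ∷ []) ∷ clause (neg 0F ∷ pos 1F ∷ []) ∷ []

-- u and v are the left and right predecessors of w.
u v w : Fin 4 → Fin 12
u = combine {3} 0F
v = combine {3} 1F
w = combine {3} 2F

leftClauses rightClauses innerClauses : List (Clause 12)
leftClauses =
  clause (neg (u 0F) ∷ pos (u 1F) ∷ pos (w 0F) ∷ pos (w 2F) ∷ []) ∷
  clause (pos (u 0F) ∷ neg (u 1F) ∷ pos (w 0F) ∷ pos (w 2F) ∷ []) ∷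
  clause (neg (u 0F) ∷ pos (u 1F) ∷ neg (w 0F) ∷ pos (w 3F) ∷ []) ∷
  clause (pos (u 0F) ∷ neg (u 1F) ∷ neg (w 0F) ∷ pos (w 3F) ∷ []) ∷ []
rightClauses =
  clause (neg (v 0F) ∷ pos (v 1F) ∷ pos (w 1F) ∷ neg (w 2F) ∷ []) ∷
  clause (pos (v 0F) ∷ neg (v 1F) ∷ pos (w 1F) ∷ neg (w 2F) ∷ []) ∷
  clause (neg (v 0F) ∷ pos (v 1F) ∷ neg (w 1F) ∷ neg (w 3F) ∷ []) ∷
  clause (pos (v 0F) ∷ neg (v 1F) ∷ neg (w 1F) ∷ neg (w 3F) ∷ []) ∷ []
innerClauses = leftClauses ++ rightClauses

odd-true : ∀ B → value B ≡ true → All (lookup B ⊨_) oddClauses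
odd-true (true  ∷ false ∷ _) _ = (0F , refl) ∷ (1F , refl) ∷ []
odd-true (false ∷ true  ∷ _) _ = (1F , refl) ∷ (0F , refl) ∷ []

even-true : ∀ B → value B ≡ false → All (lookup B ⊨_) evenClauses
even-true (true  ∷ true  ∷ _) _ = (0F , refl) ∷ (1F , refl) ∷ []
even-true (false ∷ false ∷ _) _ = (1F , refl) ∷ (0F , refl) ∷ []

blocks : Vec Block 3 → Fin 12 → Bool
blocks B x = let t , r = remQuot {3} 4 x in lookup (lookup B t) r

left-true : ∀ B₀ B₁ B₂ → (value B₀ ≡ true → onLeft B₂ ≡ true) → All (blocks (B₀ ∷ B₁ ∷ B₂ ∷ []) ⊨_) leftClauses
left-true (true ∷ true ∷ _) _ _ _ = (u 1F , refl) ∷ (u 0F , refl) ∷ (u 1F , refl) ∷ (u 0F , refl) ∷ []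
left-true (true ∷ false ∷ _) _ (true ∷ _ ∷ _ ∷ true ∷ []) _ = (w 0F , refl) ∷ (u 0F , refl) ∷ (w 3F , refl) ∷ (u 0F , refl) ∷ []
left-true (true ∷ false ∷ _) _ (true ∷ _ ∷ _ ∷ false ∷ []) h = contradiction (h refl) λ ()
left-true (true ∷ false ∷ _) _ (false ∷ _ ∷ true ∷ _ ∷ []) _ = (w 2F , refl) ∷ (u 0F , refl) ∷ (w 0F , refl) ∷ (u 0F , refl) ∷ []
left-true (true ∷ false ∷ _) _ (false ∷ _ ∷ false ∷ _ ∷ []) h = contradiction (h refl) λ ()
left-true (false ∷ true ∷ _) _ (true ∷ _ ∷ _ ∷ true ∷ []) _ = (u 0F , refl) ∷ (w 0F , refl) ∷ (u 0F , refl) ∷ (w 3F , refl) ∷ []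
left-true (false ∷ true ∷ _) _ (true ∷ _ ∷ _ ∷ false ∷ []) h = contradiction (h refl) λ ()
left-true (false ∷ true ∷ _) _ (false ∷ _ ∷ true ∷ _ ∷ []) _ = (u 0F , refl) ∷ (w 2F , refl) ∷ (u 0F , refl) ∷ (w 0F , refl) ∷ []
left-true (false ∷ true ∷ _) _ (false ∷ _ ∷ false ∷ _ ∷ []) h = contradiction (h refl) λ ()
left-true (false ∷ false ∷ _) _ _ _ = (u 0F , refl) ∷ (u 1F , refl) ∷ (u 0F , refl) ∷ (u 1F , refl) ∷ []

right-true : ∀ B₀ B₁ B₂ → (value B₁ ≡ true → onRight B₂ ≡ true) → All (blocks (B₀ ∷ B₁ ∷ B₂ ∷ []) ⊨_) rightClauses
right-true _ (true ∷ true ∷ _) _ _ = (v 1F , refl) ∷ (v 0F , refl) ∷ (v 1F , refl) ∷ (v 0F , refl) ∷ []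
right-true _ (true ∷ false ∷ _) (_ ∷ true ∷ _ ∷ true ∷ []) h = contradiction (h refl) λ ()
right-true _ (true ∷ false ∷ _) (_ ∷ true ∷ _ ∷ false ∷ []) _ = (w 1F , refl) ∷ (v 0F , refl) ∷ (w 3F , refl) ∷ (v 0F , refl) ∷ []
right-true _ (true ∷ false ∷ _) (_ ∷ false ∷ true ∷ _ ∷ []) h = contradiction (h refl) λ ()
right-true _ (true ∷ false ∷ _) (_ ∷ false ∷ false ∷ _ ∷ []) _ = (w 2F , refl) ∷ (v 0F , refl) ∷ (w 1F , refl) ∷ (v 0F , refl) ∷ []
right-true _ (false ∷ true ∷ _) (_ ∷ true ∷ _ ∷ true ∷ []) h = contradiction (h refl) λ ()
right-true _ (false ∷ true ∷ _) (_ ∷ true ∷ _ ∷ false ∷ []) _ = (v 0F , refl) ∷ (w 1F , refl) ∷ (v 0F , refl) ∷ (w 3F , refl) ∷ []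
right-true _ (false ∷ true ∷ _) (_ ∷ false ∷ true ∷ _ ∷ []) h = contradiction (h refl) λ ()
right-true _ (false ∷ true ∷ _) (_ ∷ false ∷ false ∷ _ ∷ []) _ = (v 0F , refl) ∷ (w 2F , refl) ∷ (v 0F , refl) ∷ (w 1F , refl) ∷ []
right-true _ (false ∷ false ∷ _) _ _ = (v 0F , refl) ∷ (v 1F , refl) ∷ (v 0F , refl) ∷ (v 1F , refl) ∷ []

inner-true : ∀ B₀ B₁ B₂ → (value B₀ ≡ true → onLeft B₂ ≡ true) → (value B₁ ≡ true → onRight B₂ ≡ true) →
  All (blocks (B₀ ∷ B₁ ∷ B₂ ∷ []) ⊨_) innerClauses
inner-true B₀ B₁ B₂ l r = All.++⁺ (left-true B₀ B₁ B₂ l) (right-true B₀ B₁ B₂ r)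

module Pyramid (H : ℕ) where

  N : ℕ
  N = suc H

  toℕ-mod : ∀ {n} → n < N → toℕ (n mod N) ≡ n
  toℕ-mod {n} n<N = trans (Fin.toℕ-fromℕ< (m%n<n n N)) (m<n⇒m%n≡m n<N)

  abstract

    V : ℕ
    V = N * (N * 4)

    -- Coordinates beyond H are junk.
    var : ℕ → ℕ → Fin 4 → Fin V
    var j i r = combine (j mod N) (combine (i mod N) r)

    inBlock : Fin N × Fin (N * 4) → Fin N × Fin N × Fin 4
    inBlock (j , y) = j , remQuot 4 y

    decode : Fin V → Fin N × Fin N × Fin 4
    decode x = inBlock (remQuot (N * 4) x)

    vertexOf : Fin V → ℕ × ℕ
    vertexOf x = toℕ (proj₁ (decode x)) , toℕ (proj₁ (proj₂ (decode x)))

    slot : Fin V → Fin 4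
    slot x = proj₂ (proj₂ (decode x))

    decode-var : ∀ j i r → decode (var j i r) ≡ (j mod N , i mod N , r)
    decode-var j i r = trans (cong inBlock (Fin.remQuot-combine (j mod N) (combine (i mod N) r)))
      (cong (j mod N ,_) (Fin.remQuot-combine (i mod N) r))

    vertexOf-var : ∀ {j i} r → j < N → i < N → vertexOf (var j i r) ≡ (j , i)
    vertexOf-var {j} {i} r j<N i<N = trans
      (cong (λ d → toℕ (proj₁ d) , toℕ (proj₁ (proj₂ d))) (decode-var j i r))
      (cong₂ _,_ (toℕ-mod j<N) (toℕ-mod i<N))

    slot-var : ∀ j i r → slot (var j i r) ≡ r
    slot-var j i r = cong (proj₂ ∘ proj₂) (decode-var j i r)

  corner : ℕ → ℕ → Fin 3 → ℕ × ℕ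
  corner j i 0F = j , i
  corner j i 1F = j , suc i
  corner j i 2F = suc j , i

  local : ℕ → ℕ → Fin 12 → Fin V
  local j i x = let t , r = remQuot {3} 4 x ; j′ , i′ = corner j i t in var j′ i′ r

  inner : ℕ × ℕ → CNF V
  inner (j , i) = map (rename (local j i)) innerClauses

  -- A square rather than the triangle below the sink, so that the two coordinates range
  -- independently.
  grid : List (ℕ × ℕ)
  grid = cartesianProduct (upTo H) (upTo H)

  sources : CNF V
  sources = concatMap (λ i → map (rename (var 0 i)) oddClauses) (upTo N)

  pyramid : CNF V
  pyramid = sources ++ concatMap inner grid ++ map (rename (var H 0)) evenClauses

  var-injective : ∀ j i → Injective _≡_ _≡_ (var j i)
  var-injective j i {r} {s} eq = trans (sym (slot-var j i r)) (trans (cong slot eq) (slot-var j i s))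

  corner-injective : ∀ j i {s t} → corner j i s ≡ corner j i t → s ≡ t
  corner-injective j i {0F} {0F} _ = refl
  corner-injective j i {1F} {1F} _ = refl
  corner-injective j i {2F} {2F} _ = refl
  corner-injective j i {0F} {1F} eq = contradiction (sym (cong proj₂ eq)) 1+n≢n
  corner-injective j i {0F} {2F} eq = contradiction (sym (cong proj₁ eq)) 1+n≢n
  corner-injective j i {1F} {0F} eq = contradiction (cong proj₂ eq) 1+n≢n
  corner-injective j i {1F} {2F} eq = contradiction (sym (cong proj₁ eq)) 1+n≢n
  corner-injective j i {2F} {0F} eq = contradiction (cong proj₁ eq) 1+n≢n
  corner-injective j i {2F} {1F} eq = contradiction (cong proj₁ eq) 1+n≢n

  corner<N : ∀ {j i} → j < H → i < H → ∀ t → proj₁ (corner j i t) < N × proj₂ (corner j i t) < N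
  corner<N j<H i<H 0F = m<n⇒m<1+n j<H , m<n⇒m<1+n i<H
  corner<N j<H i<H 1F = m<n⇒m<1+n j<H , s≤s i<H
  corner<N j<H i<H 2F = s≤s j<H , m<n⇒m<1+n i<H

  vertexOf-local : ∀ {j i} → j < H → i < H → ∀ x → vertexOf (local j i x) ≡ corner j i (proj₁ (remQuot {3} 4 x))
  vertexOf-local {j} {i} j<H i<H x = let t , r = remQuot {3} 4 x ; p , q = corner<N j<H i<H t in vertexOf-var r p q

  slot-local : ∀ j i x → slot (local j i x) ≡ proj₂ (remQuot {3} 4 x)
  slot-local j i x = let t , r = remQuot {3} 4 x ; j′ , i′ = corner j i t in slot-var j′ i′ r

  local-injective : ∀ {j i} → j < H → i < H → Injective _≡_ _≡_ (local j i)
  local-injective {j} {i} j<H i<H {x} {y} eq = begin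
    x                                     ≡⟨ Fin.combine-remQuot {3} 4 x ⟨
    combine (proj₁ (rq x)) (proj₂ (rq x)) ≡⟨ cong₂ combine
      (corner-injective j i (trans (sym (vertexOf-local j<H i<H x)) (trans (cong vertexOf eq) (vertexOf-local j<H i<H y))))
      (trans (sym (slot-local j i x)) (trans (cong slot eq) (slot-local j i y))) ⟩
    combine (proj₁ (rq y)) (proj₂ (rq y)) ≡⟨ Fin.combine-remQuot {3} 4 y ⟩
    y                                     ∎
    where
    open ≡-Reasoning
    rq : Fin 12 → Fin 3 × Fin 4
    rq = remQuot {3} 4

  World : Set
  World = ℕ → ℕ → Block

  assign : World → Fin V → Bool
  assign β x = let j , i = vertexOf x in lookup (β j i) (slot x)

  assign-var : ∀ β {j i} r → j < N → i < N → lookup (β j i) r ≡ assign β (var j i r)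
  assign-var β {j} {i} r j<N i<N = sym (cong₂ (λ p s → lookup (β (proj₁ p) (proj₂ p)) s)
    (vertexOf-var r j<N i<N) (slot-var j i r))

  -- Level 0 has no predecessors; the default `false` makes the two implications in `Obeys` vacuous
  -- there.
  lefts rights : (ℕ → ℕ → Bool) → ℕ → ℕ → Bool
  lefts h zero    i = false
  lefts h (suc j) i = h j i
  rights h zero    i = false
  rights h (suc j) i = h j (suc i)

  ObeysAt : (ℕ → ℕ → Bool) → ℕ → ℕ → Block → Set
  ObeysAt h j i = Obeys (h j i) (lefts h j i) (rights h j i)

  Lifts : (ℕ → ℕ → Bool) → World → Set
  Lifts h β = ∀ j i → ObeysAt h j i (β j i)

  ∈-renamed : ∀ {m} (σ : Fin m → Fin V) (α : Fin V → Bool) → Injective _≡_ _≡_ σ → ∀ {Cs C} →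
    All ((α ∘ σ) ⊨_) Cs → C ∈ map (rename σ) Cs → α ⊨ C
  ∈-renamed σ α inj holds C∈ with ∈-map⁻ (rename σ) C∈
  ... | D , D∈ , refl = ⊨-rename inj D (All.lookup holds D∈)

  Source Interior Sink : Clause V → Set
  Source   C = ∃[ i ] i < N × C ∈ map (rename (var 0 i)) oddClauses
  Interior C = ∃[ j ] ∃[ i ] j < H × i < H × C ∈ inner (j , i)
  Sink     C = C ∈ map (rename (var H 0)) evenClauses

  pyramid⁻ : ∀ {C} → C ∈ pyramid → Source C ⊎ Interior C ⊎ Sink C
  pyramid⁻ C∈ with ∈-++⁻ sources C∈
  ... | inj₁ C∈s = let i , i∈ , C∈i = find (∈-concatMap⁻ (λ i → map (rename (var 0 i)) oddClauses) {xs = upTo N} C∈s)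
                   in inj₁ (i , ∈-upTo⁻ i∈ , C∈i)
  ... | inj₂ C∈r with ∈-++⁻ (concatMap inner grid) C∈r
  ...   | inj₂ C∈k = inj₂ (inj₂ C∈k)
  ...   | inj₁ C∈g with find (∈-concatMap⁻ inner {xs = grid} C∈g)
  ...     | (j , i) , ji∈ , C∈ji = let j∈ , i∈ = ∈-cartesianProduct⁻ (upTo H) (upTo H) ji∈
                                   in inj₂ (inj₁ (j , i , ∈-upTo⁻ j∈ , ∈-upTo⁻ i∈ , C∈ji))

  source-true : ∀ {h β i} → Lifts h β → i < N → h 0 i ≡ true → ∀ {C} → C ∈ map (rename (var 0 i)) oddClauses → assign β ⊨ C
  source-true {h} {β} {i} lifts i<N h≡ = ∈-renamed (var 0 i) (assign β) (var-injective 0 i)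
    (All.map (λ {C} → ⊨-cong {C = C} λ r → assign-var β r z<s i<N)
      (odd-true (β 0 i) (trans (Obeys.value≡ (lifts 0 i)) h≡)))

  sink-true : ∀ {h β} → Lifts h β → h H 0 ≡ false → ∀ {C} → C ∈ map (rename (var H 0)) evenClauses → assign β ⊨ C
  sink-true {h} {β} lifts h≡ = ∈-renamed (var H 0) (assign β) (var-injective H 0)
    (All.map (λ {C} → ⊨-cong {C = C} λ r → assign-var β r ≤-refl z<s)
      (even-true (β H 0) (trans (Obeys.value≡ (lifts H 0)) h≡)))

  interior-true : ∀ {h β j i} → Lifts h β → j < H → i < H → ∀ {C} → C ∈ inner (j , i) → assign β ⊨ C
  interior-true {h} {β} {j} {i} lifts j<H i<H = ∈-renamed (local j i) (assign β) (local-injective j<H i<H)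
    (All.map (λ {C} → ⊨-cong {C = C} agree)
      (inner-true (β j i) (β j (suc i)) (β (suc j) i)
        (λ v≡ → left⇒ (trans (sym (Obeys.value≡ (lifts j i))) v≡))
        (λ v≡ → right⇒ (trans (sym (Obeys.value≡ (lifts j (suc i)))) v≡))))
    where
    open Obeys (lifts (suc j) i)
    Bs : Vec Block 3
    Bs = β j i ∷ β j (suc i) ∷ β (suc j) i ∷ []
    corners : ∀ t r → lookup (lookup Bs t) r ≡ lookup (β (proj₁ (corner j i t)) (proj₂ (corner j i t))) r
    corners 0F r = refl
    corners 1F r = refl
    corners 2F r = refl
    agree : ∀ x → blocks Bs x ≡ assign β (local j i x)
    agree x = let t , r = remQuot {3} 4 x ; p , q = corner<N j<H i<H t
              in trans (corners t r) (assign-var β r p q)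

-- Finite sets of vertices and their neighbourhoods

Vertex : Set
Vertex = ℕ × ℕ

_≟ᵛ_ : DecidableEquality Vertex
_≟ᵛ_ = Product.≡-dec _≟ⁿ_ _≟ⁿ_

open import Data.List.Membership.DecPropositional _≟ᵛ_ using () renaming (_∈?_ to _∈ᵛ?_)

insert : Vertex → Rows → Rows
insert (j₀ , i) U j with j₀ ≟ⁿ j
... | yes _ = i ∷ U j
... | no  _ = U j

rows : List Vertex → Rows
rows = foldr insert (λ _ → [])

∈-insert-here : ∀ j i U → i ∈ insert (j , i) U j
∈-insert-here j i U with j ≟ⁿ j
... | yes _  = here refl
... | no j≢j = ⊥-elim (j≢j refl)

∈-insert-there : ∀ p U {j} → U j ⊆ insert p U j
∈-insert-there (j₀ , i) U {j} i∈ with j₀ ≟ⁿ j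
... | yes _ = there i∈
... | no  _ = i∈

insert-other : ∀ {j₀ j} i U → j₀ ≢ j → insert (j₀ , i) U j ≡ U j
insert-other {j₀} {j} i U j₀≢j with j₀ ≟ⁿ j
... | yes eq = ⊥-elim (j₀≢j eq)
... | no  _  = refl

∈-rows : ∀ {L j i} → (j , i) ∈ L → i ∈ rows L j
∈-rows {_ ∷ L} {j} {i} (here refl) = ∈-insert-here j i (rows L)
∈-rows {p ∷ L} (there ji∈) = ∈-insert-there p (rows L) (∈-rows ji∈)

prefix-insert-below : ∀ {j₀} i U n → n ≤ j₀ → prefix (sizes (insert (j₀ , i) U)) n ≡ prefix (sizes U) n
prefix-insert-below i U zero    _     = refl
prefix-insert-below i U (suc n) n<j₀ = cong₂ _+_ (prefix-insert-below i U n (<⇒≤ n<j₀))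
  (cong length (insert-other i U (>⇒≢ n<j₀)))

prefix-insert-above : ∀ {j₀} i U {n} → suc j₀ ≤′ n → prefix (sizes (insert (j₀ , i) U)) n ≡ suc (prefix (sizes U) n)
prefix-insert-above {j₀} i U ≤′-refl = trans
  (cong₂ _+_ (prefix-insert-below i U j₀ ≤-refl) here-size) (+-suc (prefix (sizes U) j₀) (sizes U j₀))
  where
  here-size : sizes (insert (j₀ , i) U) j₀ ≡ suc (sizes U j₀)
  here-size with j₀ ≟ⁿ j₀
  ... | yes _  = refl
  ... | no j≢j = ⊥-elim (j≢j refl)
prefix-insert-above i U (≤′-step {n = n} j₀<n) = cong₂ _+_ (prefix-insert-above i U j₀<n)
  (cong length (insert-other i U (<⇒≢ (≤′⇒≤ j₀<n))))

prefix-insert : ∀ p U n → prefix (sizes (insert p U)) n ≤ suc (prefix (sizes U) n)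
prefix-insert (j₀ , i) U n with n ≤? j₀
... | yes n≤j₀ = m≤n⇒m≤1+n (≤-reflexive (prefix-insert-below i U n n≤j₀))
... | no  n≰j₀ = ≤-reflexive (prefix-insert-above i U (≤⇒≤′ (≰⇒> n≰j₀)))

prefix-rows : ∀ L n → prefix (sizes (rows L)) n ≤ length L
prefix-rows []      n = ≤-reflexive (prefix-0 n)
  where
  prefix-0 : ∀ n → prefix (λ _ → 0) n ≡ 0
  prefix-0 zero    = refl
  prefix-0 (suc n) = trans (+-identityʳ _) (prefix-0 n)
prefix-rows (p ∷ L) n = ≤-trans (prefix-insert p (rows L) n) (s≤s (prefix-rows L n))

-- At level 0 the condition is just a bound on the total, supplied by `room`. For higher levels the
-- new vertex lies below and its contributions to the two prefix sums cancel.
low-insert : ∀ {K} i U → 3 * suc (prefix (sizes U) K) ≤ K → Low K (sizes U) → Low K (sizes (insert (0 , i) U))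
low-insert {K} i U room low {zero}  _   = ≤-trans (*-monoʳ-≤ 3 (prefix-insert (0 , i) U K)) (≤-trans room (m≤m+n K 0))
low-insert {K} i U room low {suc j} j<K = begin
  suc j + 3 * prefix (sizes (insert (0 , i) U)) K        ≤⟨ +-monoʳ-≤ (suc j) (*-monoʳ-≤ 3 (prefix-insert (0 , i) U K)) ⟩
  suc j + 3 * suc (prefix (sizes U) K)                   ≡⟨ id₁ (suc j) (prefix (sizes U) K) ⟩
  suc j + 3 * prefix (sizes U) K + 3                     ≤⟨ +-monoˡ-≤ 3 (low j<K) ⟩
  K + 3 * prefix (sizes U) (suc j) + 3                   ≡⟨ id₁ K (prefix (sizes U) (suc j)) ⟨
  K + 3 * suc (prefix (sizes U) (suc j))                 ≡⟨ cong (λ n → K + 3 * n) (prefix-insert-above i U (≤⇒≤′ (s≤s z≤n))) ⟨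
  K + 3 * prefix (sizes (insert (0 , i) U)) (suc j)      ∎
  where
  open ≤-Reasoning
  id₁ : ∀ j p → j + 3 * suc p ≡ j + 3 * p + 3
  id₁ = solve-∀

-- The vertices whose values enter `ObeysAt` at the given one.
neighbourhood : Vertex → List Vertex
neighbourhood (zero  , i) = (0 , i) ∷ []
neighbourhood (suc j , i) = (suc j , i) ∷ (j , i) ∷ (j , suc i) ∷ []

neighbourhoods-length : ∀ L → length (concatMap neighbourhood L) ≤ 3 * length L
neighbourhoods-length []      = z≤n
neighbourhoods-length (p ∷ L) = begin
  length (neighbourhood p ++ concatMap neighbourhood L)         ≡⟨ length-++ (neighbourhood p) ⟩
  length (neighbourhood p) + length (concatMap neighbourhood L) ≤⟨ +-mono-≤ (≤3 p) (neighbourhoods-length L) ⟩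
  3 + 3 * length L                                              ≡⟨ *-suc 3 (length L) ⟨
  3 * suc (length L)                                            ∎
  where
  open ≤-Reasoning
  ≤3 : ∀ p → length (neighbourhood p) ≤ 3
  ≤3 (zero  , i) = s≤s z≤n
  ≤3 (suc j , i) = ≤-refl

-- The lower bound on space

module LowerBound (H : ℕ) where

  open Pyramid H

  -- Only the existence of some β is asked for, as D may say more about the
  -- blocks than about the values of the vertices.
  Forces : Rows → ClauseSet V → Set
  Forces U D = ∀ {h} → Model H h → h ⊩ U → ∃[ β ] Lifts h β × All (assign β ⊨_) D

  vertices : Clause V → List Vertex
  vertices C = map vertexOf (filter (λ x → Bool.T? (is-just (lookup C x))) (allFin V))

  vertices⁺ : ∀ {C x b} → (x , b) ∈ᶜ C → vertexOf x ∈ vertices C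
  vertices⁺ {C} {x} Cx = ∈-map⁺ vertexOf (∈-filter⁺ (λ x → Bool.T? (is-just (lookup C x))) (∈-allFin x)
    (subst (Bool.T ∘ is-just) (sym Cx) _))

  vertices⁻ : ∀ {C p} → p ∈ vertices C → ∃[ x ] ∃[ b ] (x , b) ∈ᶜ C × vertexOf x ≡ p
  vertices⁻ {C} p∈ with ∈-map⁻ vertexOf p∈
  ... | x , x∈ , refl with lookup C x in Cx | proj₂ (∈-filter⁻ (λ x → Bool.T? (is-just (lookup C x))) {xs = allFin V} x∈)
  ...   | just b  | _ = x , b , Cx , refl
  ...   | nothing | ()

  open Hall _≟ᵛ_ vertices

  model-obeys : ∀ {h} → Model H h → ∀ j i → lefts h j i ≡ true → rights h j i ≡ true → h j i ≡ true
  model-obeys M zero    i ()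
  model-obeys M (suc j) i = Model.closed M

  -- Keeps the blocks of `β` in `X` and refills all others, a matched one so that a literal of its
  -- clause becomes true, which `fill` achieves under any law. Hence clauses inside `X` stay true,
  -- matched clauses become true, and `β` need obey `h` only in `X`.
  module Rebuild {h} (M : Model H h) (X : List Vertex) (β : World)
    (obeysX : ∀ j i → (j , i) ∈ X → ObeysAt h j i (β j i)) {m} (μ : Matching X m) where

    record Rebuilt (j i : ℕ) : Set where
      field
        block  : Block
        law    : ObeysAt h j i block
        kept   : (j , i) ∈ X → block ≡ β j i
        match  : ∀ {C} → (C , (j , i)) ∈ m → ∃[ x ] vertexOf x ≡ (j , i) × lookup C x ≡ just (lookup block (slot x))

    rebuild : ∀ j i → Rebuilt j i
    rebuild j i with (j , i) ∈ᵛ? X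
    ... | yes ji∈X = record
      { block = β j i ; law = obeysX j i ji∈X ; kept = λ _ → refl
      ; match = λ C∈ → ⊥-elim (Matching.avoid μ C∈ ji∈X) }
    ... | no ji∉X with any? (λ q → proj₂ q ≟ᵛ (j , i)) m
    -- No clause claims this vertex, so the literal handed to `fill` is arbitrary.
    ...   | no unmatched = let B , law , _ = fill (h j i) (lefts h j i) (rights h j i) 0F true (model-obeys M j i) in record
      { block = B ; law = law ; kept = ⊥-elim ∘ ji∉X
      ; match = λ C∈ → ⊥-elim (unmatched (lose C∈ refl)) }
    ...   | yes matched with find matched
    ...     | (C , _) , C∈ , refl with vertices⁻ {C} (Matching.edge μ C∈)
    ...       | x , b , Cx , x≡ =
      let B , law , hit = fill (h j i) (lefts h j i) (rights h j i) (slot x) b (model-obeys M j i) in record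
      { block = B ; law = law ; kept = ⊥-elim ∘ ji∉X
      ; match = λ {D} D∈ → x , x≡ , trans (cong (λ E → lookup E x) (cong proj₁ (im-injective (Matching.unique μ) D∈ C∈ refl)))
          (trans Cx (cong just (sym hit))) }

    β′ : World
    β′ j i = Rebuilt.block (rebuild j i)

    lifts : Lifts h β′
    lifts j i = Rebuilt.law (rebuild j i)

    matched-true : ∀ {C} → C ∈ dom m → assign β′ ⊨ C
    matched-true {C} C∈ with ∈-map⁻ proj₁ C∈
    ... | (_ , (j , i)) , Cp∈ , refl with Rebuilt.match (rebuild j i) Cp∈
    ...   | x , x≡ , Cx = x , trans Cx (cong (λ p → just (lookup (β′ (proj₁ p) (proj₂ p)) (slot x))) (sym x≡))

    inside-true : ∀ {C} → vertices C ⊆ X → assign β ⊨ C → assign β′ ⊨ C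
    inside-true {C} C⊆X (x , Cx) = x , trans Cx (cong (λ B → just (lookup B (slot x)))
      (sym (Rebuilt.kept (rebuild _ _) (C⊆X (vertices⁺ {C} Cx)))))

  obeys-transfer : ∀ {h h′ : ℕ → ℕ → Bool} j i {B} →
    (∀ {j′ i′} → (j′ , i′) ∈ neighbourhood (j , i) → h j′ i′ ≡ h′ j′ i′) → ObeysAt h j i B → ObeysAt h′ j i B
  obeys-transfer zero i agree (obeys v l r) = obeys (trans v (agree (here refl))) l r
  obeys-transfer (suc j) i agree (obeys v l r) = obeys (trans v (agree (here refl)))
    (λ h≡ → l (trans (agree (there (here refl))) h≡))
    (λ h≡ → r (trans (agree (there (there (here refl)))) h≡))

  -- With `X` and the matching empty, `Rebuild` shows that every model lifts; the world given to it
  -- is a dummy.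
  forces-[] : Forces (λ _ → []) []
  forces-[] M _ = β′ , lifts , []
    where open Rebuild M [] (λ _ _ → true ∷ true ∷ true ∷ true ∷ []) (λ _ _ ()) (mkMatching [] (λ ()) (λ ()))

  -- The invariant carried along a derivation. `Low` counts only levels below `K`; `high` excludes
  -- vertices elsewhere.
  record State (K : ℕ) (D : ClauseSet V) : Set where
    field
      U      : Rows
      low    : Low K (sizes U)
      high   : ∀ {j} → K ≤ j → U j ≡ []
      forces : Forces U D

  -- The factor 6 is 2 from `compress` times 3 from `neighbourhood`, while `hall` makes `X` no
  -- larger than the number of clauses.
  shrink : ∀ {K D} → K ≤ H → State K D → Σ[ S ∈ State K D ] prefix (sizes (State.U S)) K ≤ 6 * card D
  shrink {K} {D} K≤H S with hall (elements D)
  ... | X , m , X+m≤D , μ , cover with compress (rows (concatMap neighbourhood X)) (State.U S) K≤H (State.low S)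
  ...   | U′ , low′ , small , same , transfer = record
    { U = U′ ; low = low′ ; high = λ {j} K≤j → trans (same j K≤j) (State.high S K≤j) ; forces = forces′ } , bound
    where
    X⁺ : List Vertex
    X⁺ = concatMap neighbourhood X

    bound : prefix (sizes U′) K ≤ 6 * card D
    bound = begin
      prefix (sizes U′) K              ≤⟨ small ⟩
      2 * prefix (sizes (rows X⁺)) K   ≤⟨ *-monoʳ-≤ 2 (prefix-rows X⁺ K) ⟩
      2 * length X⁺                    ≤⟨ *-monoʳ-≤ 2 (neighbourhoods-length X) ⟩
      2 * (3 * length X)               ≤⟨ *-monoʳ-≤ 2 (*-monoʳ-≤ 3 (≤-trans (m≤m+n (length X) (length m)) X+m≤D)) ⟩
      2 * (3 * card D)                 ≡⟨ *-assoc 2 3 (card D) ⟨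
      6 * card D                       ∎
      where open ≤-Reasoning

    forces′ : Forces U′ D
    -- `β` lifts `h` and not `h′`, but the two agree on `X⁺`, so its blocks in `X` obey `h′` as
    -- well; the others are rebuilt for `h′`.
    forces′ {h′} M′ h′⊩ with transfer h′ M′ h′⊩
    ... | h , M , h⊩ , agree with State.forces S M h⊩
    ...   | β , lifts , true-D = β′ , lifts′ , All.tabulate holds
      where
      obeysX : ∀ j i → (j , i) ∈ X → ObeysAt h′ j i (β j i)
      obeysX j i ji∈ = obeys-transfer j i
        (λ p∈ → agree _ (∈-rows (∈-concatMap⁺ neighbourhood (lose ji∈ p∈)))) (lifts j i)
      open Rebuild M′ X β obeysX μ renaming (lifts to lifts′)
      holds : ∀ {C} → C ∈ D → assign β′ ⊨ C
      holds {C} C∈ with cover (∈-deduplicate⁺ _≟_ C∈)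
      ... | inj₁ C⊆X = inside-true {C} C⊆X (All.lookup true-D C∈)
      ... | inj₂ C∈m = matched-true C∈m

  step : ∀ {s K D E} → 18 * s + 3 ≤ K → K ≤ H → card D ≤ s → Step pyramid D E → State K D → State K E
  step {D = D} room K≤H D≤s (erase {C = C} _) S = record
    { State S ; forces = λ M h⊩ → let β , lifts , true-D = State.forces S M h⊩
                                  in β , lifts , All.filter⁺ (λ E → ¬? (E ≟ C)) true-D }
  step room K≤H D≤s (infer {R = R} P∈ Q∈ r) S = record
    { State S ; forces = λ M h⊩ → let β , lifts , true-D = State.forces S M h⊩
                                  in β , lifts , ⊨-resolvent r (All.lookup true-D P∈) (All.lookup true-D Q∈) ∷ true-D }
  step {s} {K} {D} room K≤H D≤s (download C∈) S with pyramid⁻ C∈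
  ... | inj₂ (inj₁ (j , i , j<H , i<H , C∈ji)) = record
    { State S ; forces = λ M h⊩ → let β , lifts , true-D = State.forces S M h⊩
                                  in β , lifts , interior-true lifts j<H i<H C∈ji ∷ true-D }
  ... | inj₂ (inj₂ C∈k) = record
    { State S ; forces = λ M h⊩ → let β , lifts , true-D = State.forces S M h⊩
                                  in β , lifts , sink-true lifts (Model.sink M) C∈k ∷ true-D }
  -- Shrinking first leaves room for one more vertex at level 0: 3 (6 s + 1) = 18 s + 3, which is
  -- the origin of the bound on `K`.
  ... | inj₁ (i , i<N , C∈i) with shrink K≤H S
  ...   | S′ , small = record
    { U = insert (0 , i) U
    ; low = low-insert i U (begin
        3 * suc (prefix (sizes U) K)  ≤⟨ *-monoʳ-≤ 3 (s≤s (≤-trans small (*-monoʳ-≤ 6 D≤s))) ⟩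
        3 * suc (6 * s)               ≡⟨ id₁ s ⟩
        18 * s + 3                    ≤⟨ room ⟩
        K                             ∎) low
    ; high = λ {j} K≤j → trans (insert-other i U (<⇒≢ (≤-trans (≤-trans (s≤s z≤n) (m≤n+m 3 (18 * s))) (≤-trans room K≤j)))) (high K≤j)
    ; forces = λ M h⊩ → let β , lifts , true-D = forces M (λ j → h⊩ j ∘ ∈-insert-there (0 , i) U)
                         in β , lifts , source-true lifts i<N (h⊩ 0 (∈-insert-here 0 i U)) C∈i ∷ true-D }
    where
    open State S′
    open ≤-Reasoning
    id₁ : ∀ s → 3 * suc (6 * s) ≡ 18 * s + 3
    id₁ = solve-∀

  run : ∀ {s K D E} → 18 * s + 3 ≤ K → K ≤ H → (π : Star (Step pyramid) D E) → All (λ S → card S ≤ s) (configurations π) →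
    State K D → State K E
  run room K≤H ε        _          S = S
  run room K≤H (σ ◅ π) (D≤s ∷ ≤s) S = run room K≤H π ≤s (step room K≤H D≤s σ S)

  initial : ∀ {K} → State K []
  initial {K} = record
    { U = λ _ → [] ; low = λ {j} j≤K → +-mono-≤ j≤K (*-monoʳ-≤ 3 {_} {prefix (λ _ → 0) j} (≤-trans (prefix-rows [] K) z≤n)) ; high = λ _ → refl ; forces = forces-[] }

  -- Compressing against the empty `X` empties `U`. The everywhere false model then transfers to one
  -- that makes the original `U` true, and the world forced by it would satisfy the empty clause.
  final⊥ : ∀ {K D} → K ≤ H → 𝟘 ∈ D → ¬ State K D
  final⊥ {K} K≤H 𝟘∈D S with compress (λ _ → []) (State.U S) K≤H (State.low S)
  ... | U′ , _ , small , same , transfer with transfer (λ _ _ → false) (record { closed = λ () ; sink = refl }) empty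
    where
    none : ∀ j → U′ j ≡ []
    none j with K ≤? j
    ... | yes K≤j = trans (same j K≤j) (State.high S K≤j)
    ... | no  K≰j = length≡0 (n≤0⇒n≡0 (begin
      sizes U′ j                     ≤⟨ m≤n+m (sizes U′ j) (prefix (sizes U′) j) ⟩
      prefix (sizes U′) (suc j)      ≤⟨ prefix-mono (sizes U′) (≰⇒> K≰j) ⟩
      prefix (sizes U′) K            ≤⟨ small ⟩
      2 * prefix (λ _ → 0) K         ≤⟨ *-monoʳ-≤ 2 (prefix-rows [] K) ⟩
      0                              ∎))
      where open ≤-Reasoning
    empty : (λ _ _ → false) ⊩ U′
    empty j i∈ with subst (_ ∈_) (none j) i∈
    ... | ()
  ...   | h , M , h⊩ , _ with State.forces S M h⊩
  ...     | β , _ , true-D with All.lookup true-D 𝟘∈D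
  ...       | x , 𝟘x = contradiction (trans (sym (lookup-𝟘 x)) 𝟘x) λ ()

  space-bound : ∀ (π : Refutation pyramid) {s} → refSpace π ≤ s → H < 18 * s + 3
  space-bound π {s} π≤s = ≰⇒> λ K≤H → final⊥ {18 * s + 3} K≤H (Equivalence.from final≡[𝟘] (here refl))
    (run ≤-refl K≤H derivation (space≤⇒ π π≤s) initial)
    where open Refutation π

-- Renaming of derivations

rename-update : ∀ {m v} {σ : Fin m → Fin v} → Injective _≡_ _≡_ σ → ∀ C x b →
  rename σ (C [ x ]≔ just b) ≡ rename σ C [ σ x ]≔ just b
rename-update {σ = σ} inj C x b = begin
  rename σ (C [ x ]≔ just b)                                ≡⟨ Vec.tabulate∘lookup _ ⟨
  tabulate (lookup (rename σ (C [ x ]≔ just b)))        ≡⟨ Vec.tabulate-cong pointwise ⟩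
  tabulate (lookup (rename σ C [ σ x ]≔ just b))        ≡⟨ Vec.tabulate∘lookup _ ⟩
  rename σ C [ σ x ]≔ just b                                ∎
  where
  open ≡-Reasoning
  C′ = C [ x ]≔ just b
  pointwise : ∀ y → lookup (rename σ (C [ x ]≔ just b)) y ≡ lookup (rename σ C [ σ x ]≔ just b) y
  pointwise y with Fin.any? (λ z → y Fin.≟ σ z)
  ... | no y∉ = trans (lookup-rename-outside σ C′ λ z y≡ → y∉ (z , y≡))
    (sym (trans (Vec.lookup∘updateAt′ y (σ x) (λ y≡ → y∉ (x , y≡)) (rename σ C))
      (lookup-rename-outside σ C λ z y≡ → y∉ (z , y≡))))
  ... | yes (z , refl) with z Fin.≟ x
  ...   | yes refl = trans (lookup-rename inj C′ x)
    (trans (Vec.lookup∘updateAt x C) (sym (Vec.lookup∘updateAt (σ x) (rename σ C))))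
  ...   | no z≢x = trans (lookup-rename inj C′ z) (trans (Vec.lookup∘updateAt′ z x z≢x C)
    (sym (trans (Vec.lookup∘updateAt′ (σ z) (σ x) (z≢x ∘ inj) (rename σ C)) (lookup-rename inj C z))))

rename-resolvent : ∀ {m v} {σ : Fin m → Fin v} → Injective _≡_ _≡_ σ → ∀ {P Q R} →
  IsResolvent P Q R → IsResolvent (rename σ P) (rename σ Q) (rename σ R)
rename-resolvent {σ = σ} inj {R = R} r = record
  { x = σ x ; B = rename σ B ; C = rename σ C
  ; x∉B = trans (lookup-rename inj B x) x∉B
  ; x∉C = trans (lookup-rename inj C x) x∉C
  ; P≡B∨x = trans (cong (rename σ) P≡B∨x) (rename-update inj B x true)
  ; Q≡C∨¬x = trans (cong (rename σ) Q≡C∨¬x) (rename-update inj C x false)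
  ; R≡B∨C = λ (y , b) → mk⇔ to from }
  where
  open IsResolvent r
  to : ∀ {y b} → (y , b) ∈ᶜ rename σ R → (y , b) ∈ᶜ rename σ B ⊎ (y , b) ∈ᶜ rename σ C
  to {b = b} y∈ with lookup-rename⁻ σ R y∈
  ... | z , refl , z∈ with Equivalence.to (R≡B∨C (z , b)) z∈
  ...   | inj₁ z∈B = inj₁ (trans (lookup-rename inj B z) z∈B)
  ...   | inj₂ z∈C = inj₂ (trans (lookup-rename inj C z) z∈C)
  from : ∀ {y b} → (y , b) ∈ᶜ rename σ B ⊎ (y , b) ∈ᶜ rename σ C → (y , b) ∈ᶜ rename σ R
  from {b = b} (inj₁ y∈) with lookup-rename⁻ σ B y∈
  ... | z , refl , z∈ = trans (lookup-rename inj R z) (Equivalence.from (R≡B∨C (z , b)) (inj₁ z∈))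
  from {b = b} (inj₂ y∈) with lookup-rename⁻ σ C y∈
  ... | z , refl , z∈ = trans (lookup-rename inj R z) (Equivalence.from (R≡B∨C (z , b)) (inj₂ z∈))

width-update : ∀ {v} (C : Clause v) x b → ∣ C [ x ]≔ just b ∣ᶜ ≤ suc ∣ C ∣ᶜ
width-update (just _ ∷ C)  zero    b = n≤1+n _
width-update (nothing ∷ C) zero    b = ≤-refl
width-update (just _ ∷ C)  (suc x) b = s≤s (width-update C x b)
width-update (nothing ∷ C) (suc x) b = width-update C x b

width-𝟘 : ∀ v → ∣ 𝟘 {v} ∣ᶜ ≡ 0
width-𝟘 zero    = refl
width-𝟘 (suc v) = width-𝟘 v

width-rename : ∀ {m v} (σ : Fin m → Fin v) C → ∣ rename σ C ∣ᶜ ≤ ∣ C ∣ᶜ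
width-rename {v = v} σ [] = ≤-reflexive (width-𝟘 v)
width-rename σ (nothing ∷ C) = width-rename (σ ∘ suc) C
width-rename σ (just b ∷ C)  = ≤-trans (width-update (rename (σ ∘ suc) C) (σ zero) b) (s≤s (width-rename (σ ∘ suc) C))

-- The last line of the derivation comes first.
data Derivation {m} (A Γ : ClauseSet m) : List (Clause m) → Set where
  []  : Derivation A Γ []
  _∷_ : ∀ {C Δ} → Derivable A (Δ ++ Γ) C → Derivation A Γ Δ → Derivation A Γ (C ∷ Δ)

module _ {m v} {σ : Fin m → Fin v} (inj : Injective _≡_ _≡_ σ) {A Γ : ClauseSet m} {F : CNF v} (A⊆F : map (rename σ) A ⊆ F)
  (G : DownSet v) where

  open Moves F G
  open DownSet G

  rename-derivable : ∀ {S Δ C} → map (rename σ) Γ ⊆ S → Derivable A (Δ ++ Γ) C →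
    Derivable F (map (rename σ) Δ ++ S) (rename σ C)
  rename-derivable Γ⊆S (axiom C∈A) = axiom (A⊆F (∈-map⁺ (rename σ) C∈A))
  rename-derivable {S} {Δ} Γ⊆S (resolvent P∈ Q∈ r) = resolvent (premise P∈) (premise Q∈) (rename-resolvent inj r)
    where
    premise : ∀ {P} → P ∈ Δ ++ Γ → rename σ P ∈ map (rename σ) Δ ++ S
    premise P∈ with ∈-++⁻ Δ P∈
    ... | inj₁ P∈Δ = ∈-++⁺ˡ (∈-map⁺ (rename σ) P∈Δ)
    ... | inj₂ P∈Γ = ∈-++⁺ʳ (map (rename σ) Δ) (Γ⊆S (∈-map⁺ (rename σ) P∈Γ))

  -- Nothing is erased on the way, so every configuration is contained in the last one and `Holds`
  -- is asked of that one alone.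
  rename-derivation : ∀ {S Δ} → map (rename σ) Γ ⊆ S → Derivation A Γ Δ → Holds (map (rename σ) Δ ++ S) →
    Star Move S (map (rename σ) Δ ++ S)
  rename-derivation Γ⊆S []            h = ε
  rename-derivation {S} {C ∷ Δ} Γ⊆S (d ∷ δ) h = rename-derivation Γ⊆S δ (down there h) ◅◅
    extend (rename-derivable {S} {Δ} Γ⊆S d) (λ D∈ → D∈) h ◅ ε

-- Derivations at a single vertex and at the sink

module _ {m} {A S : ClauseSet m} {C : Clause m} where

  ax : {_ : True (C ∈? A)} → Derivable A S C
  ax {C∈A} = axiom (toWitness C∈A)

  res : ∀ P Q {_ : True (P ∈? S)} {_ : True (Q ∈? S)} {_ : True (resolvent? P Q C)} → Derivable A S C
  res P Q {P∈S} {Q∈S} {r} = resolvent (toWitness P∈S) (toWitness Q∈S) (toWitness r)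

oddAt : (Fin 4 → Fin 12) → List (Clause 12)
oddAt a = clause (pos (a 0F) ∷ pos (a 1F) ∷ []) ∷ clause (neg (a 0F) ∷ neg (a 1F) ∷ []) ∷ []

-- The last two clauses say that a true vertex `a` implies `K`. Resolving them on the first variable
-- of `a` with the clauses that state its truth, and then on the second, leaves `K`.
cut : (a : Fin 4 → Fin 12) (K : List (Literal 12)) → List (Clause 12)
cut a K =
  clause K ∷
  clause (neg (a 1F) ∷ K) ∷
  clause (pos (a 1F) ∷ K) ∷
  clause (pos (a 0F) ∷ neg (a 1F) ∷ K) ∷
  clause (neg (a 0F) ∷ pos (a 1F) ∷ K) ∷ []

-- The clauses of `onLeft` and `onRight`. `left₁` and `right₁` resolve on z₁, `left₂` and `right₂`
-- on z₂, to the two clauses for w₁ ≠ w₂.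
left₁ left₂ right₁ right₂ : List (Literal 12)
left₁  = pos (w 0F) ∷ pos (w 2F) ∷ []
left₂  = neg (w 0F) ∷ pos (w 3F) ∷ []
right₁ = pos (w 1F) ∷ neg (w 2F) ∷ []
right₂ = neg (w 1F) ∷ neg (w 3F) ∷ []

premises innerLines : List (Clause 12)
premises = oddAt u ++ oddAt v
innerLines = oddAt w ++ cut u left₁ ++ cut u left₂ ++ cut v right₁ ++ cut v right₂

innerDerivation : Derivation innerClauses premises innerLines
innerDerivation =
  res (clause left₁) (clause right₁) ∷ res (clause left₂) (clause right₂) ∷
  res (clause (pos (u 1F) ∷ left₁)) (clause (neg (u 1F) ∷ left₁)) ∷
  res (clause (pos (u 0F) ∷ neg (u 1F) ∷ left₁)) (clause (neg (u 0F) ∷ neg (u 1F) ∷ [])) ∷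
  res (clause (pos (u 0F) ∷ pos (u 1F) ∷ [])) (clause (neg (u 0F) ∷ pos (u 1F) ∷ left₁)) ∷
  ax ∷ ax ∷
  res (clause (pos (u 1F) ∷ left₂)) (clause (neg (u 1F) ∷ left₂)) ∷
  res (clause (pos (u 0F) ∷ neg (u 1F) ∷ left₂)) (clause (neg (u 0F) ∷ neg (u 1F) ∷ [])) ∷
  res (clause (pos (u 0F) ∷ pos (u 1F) ∷ [])) (clause (neg (u 0F) ∷ pos (u 1F) ∷ left₂)) ∷
  ax ∷ ax ∷
  res (clause (pos (v 1F) ∷ right₁)) (clause (neg (v 1F) ∷ right₁)) ∷
  res (clause (pos (v 0F) ∷ neg (v 1F) ∷ right₁)) (clause (neg (v 0F) ∷ neg (v 1F) ∷ [])) ∷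
  res (clause (pos (v 0F) ∷ pos (v 1F) ∷ [])) (clause (neg (v 0F) ∷ pos (v 1F) ∷ right₁)) ∷
  ax ∷ ax ∷
  res (clause (pos (v 1F) ∷ right₂)) (clause (neg (v 1F) ∷ right₂)) ∷
  res (clause (pos (v 0F) ∷ neg (v 1F) ∷ right₂)) (clause (neg (v 0F) ∷ neg (v 1F) ∷ [])) ∷
  res (clause (pos (v 0F) ∷ pos (v 1F) ∷ [])) (clause (neg (v 0F) ∷ pos (v 1F) ∷ right₂)) ∷
  ax ∷ ax ∷
  []

sinkLines : List (Clause 4)
sinkLines = 𝟘 ∷ clause (neg 1F ∷ []) ∷ clause (pos 1F ∷ []) ∷ evenClauses

sinkDerivation : Derivation evenClauses oddClauses sinkLines
sinkDerivation =
  res (clause (pos 1F ∷ [])) (clause (neg 1F ∷ [])) ∷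
  res (clause (pos 0F ∷ neg 1F ∷ [])) (clause (neg 0F ∷ neg 1F ∷ [])) ∷
  res (clause (pos 0F ∷ pos 1F ∷ [])) (clause (neg 0F ∷ pos 1F ∷ [])) ∷
  ax ∷ ax ∷ []

-- The refutation row by row and its measures

infixr 6 _⊓ᵈ_

_⊓ᵈ_ : ∀ {v} → DownSet v → DownSet v → DownSet v
G ⊓ᵈ G′ = record
  { Holds  = λ S → DownSet.Holds G S × DownSet.Holds G′ S
  ; holds? = λ S → DownSet.holds? G S ×-dec DownSet.holds? G′ S
  ; down   = λ S⊆T (h , h′) → DownSet.down G S⊆T h , DownSet.down G′ S⊆T h′ }

concatMap-length : ∀ {A B : Set} (f : A → List B) n xs → (∀ x → length (f x) ≡ n) → length (concatMap f xs) ≡ length xs * n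
concatMap-length f n []       _ = refl
concatMap-length f n (x ∷ xs) eq = trans (length-++ (f x)) (cong₂ _+_ (eq x) (concatMap-length f n xs eq))

cartesianProduct-length : ∀ {A B : Set} (xs : List A) (ys : List B) → length (cartesianProduct xs ys) ≡ length xs * length ys
cartesianProduct-length []       ys = refl
cartesianProduct-length (x ∷ xs) ys = trans (length-++ (map (x ,_) ys))
  (cong₂ _+_ (length-map (x ,_) ys) (cartesianProduct-length xs ys))

refutation⇒unsatisfiable : ∀ {v} {F : CNF v} → Refutation F → Unsatisfiable F
refutation⇒unsatisfiable {F = F} ρ (α , α⊨) with All.lookup (sound derivation []) (Equivalence.from final≡[𝟘] (here refl))
  where
  open Refutation ρ
  sound : ∀ {S T} → Star (Step F) S T → All (α ⊨_) S → All (α ⊨_) T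
  sound ε                     true-S = true-S
  sound (download C∈ ◅ π)     true-S = sound π (All.lookup α⊨ C∈ ∷ true-S)
  sound (erase {C = C} _ ◅ π) true-S = sound π (All.filter⁺ (λ D → ¬? (D ≟ C)) true-S)
  sound (infer P∈ Q∈ r ◅ π)   true-S = sound π (⊨-resolvent r (All.lookup true-S P∈) (All.lookup true-S Q∈) ∷ true-S)
... | x , 𝟘x = contradiction (trans (sym (lookup-𝟘 x)) 𝟘x) λ ()

module UpperBound (H : ℕ) where

  open Pyramid H

  inners : ℕ × ℕ → CNF V
  inners (j , i) = map (rename (local j i)) innerLines

  lines : CNF V
  lines = sources ++ concatMap inners grid ++ map (rename (var H 0)) sinkLines

  -- Two rows of at most `N` vertices with two clauses each, and the 22 `innerLines`.
  maxSpace : ℕ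
  maxSpace = 4 * N + 22

  -- Containment in `lines` bounds length and width at once, as `lines` is short and its clauses are
  -- narrow.
  bounds : DownSet V
  bounds = spaceAtMost {F = pyramid} maxSpace ⊓ᵈ within {F = pyramid} lines

  open Moves pyramid bounds
  open DownSet bounds

  bounded : ∀ {S} → length S ≤ maxSpace → S ⊆ lines → Holds S
  bounded {S} S≤ S⊆ = ≤-trans (card≤ {S = S} {S} (λ C∈ → C∈)) S≤ , S⊆

  odd : ℕ → ℕ → ClauseSet V
  odd j i = map (rename (var j i)) oddClauses

  row : ℕ → ℕ → ClauseSet V
  row j zero    = []
  row j (suc m) = odd j m ++ row j m

  row-length : ∀ j m → length (row j m) ≡ m * 2
  row-length j zero    = refl
  row-length j (suc m) = cong (2 +_) (row-length j m)

  odd⊆row : ∀ j {i m} → i < m → odd j i ⊆ row j m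
  odd⊆row j {i} {suc m} i<1+m C∈ with m≤n⇒m<n∨m≡n i<1+m
  ... | inj₁ i<m  = ∈-++⁺ʳ (odd j m) (odd⊆row j (≤-pred i<m) C∈)
  ... | inj₂ refl = ∈-++⁺ˡ C∈

  source⊆ : ∀ {i} → i < N → odd 0 i ⊆ sources
  source⊆ i<N C∈ = ∈-concatMap⁺ (odd 0) (lose (∈-upTo⁺ i<N) C∈)

  interior⊆ : ∀ (f : ℕ × ℕ → CNF V) {j i} → j < H → i < H → f (j , i) ⊆ concatMap f grid
  interior⊆ f j<H i<H C∈ = ∈-concatMap⁺ f (lose (∈-cartesianProduct⁺ (∈-upTo⁺ j<H) (∈-upTo⁺ i<H)) C∈)

  axioms⊆ : ∀ {j i} → j < H → i < H → map (rename (local j i)) innerClauses ⊆ pyramid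
  axioms⊆ j<H i<H C∈ = ∈-++⁺ʳ sources (∈-++⁺ˡ (interior⊆ inner j<H i<H C∈))

  innerLines⊆ : ∀ {j i} → j < H → i < H → map (rename (local j i)) innerLines ⊆ lines
  innerLines⊆ j<H i<H C∈ = ∈-++⁺ʳ sources (∈-++⁺ˡ
    (interior⊆ inners j<H i<H C∈))

  odd⊆innerLines : ∀ j i → odd (suc j) i ⊆ map (rename (local j i)) innerLines
  odd⊆innerLines j i (here p)         = here p
  odd⊆innerLines j i (there (here p)) = there (here p)

  row⊆lines : ∀ j m → j + m ≤ N → row j m ⊆ lines
  row⊆lines zero    (suc m) m<N   C∈ with ∈-++⁻ (odd 0 m) C∈
  ... | inj₁ C∈odd = ∈-++⁺ˡ (source⊆ m<N C∈odd)
  ... | inj₂ C∈row = row⊆lines zero m (<⇒≤ m<N) C∈row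
  row⊆lines (suc j) (suc m) j+m<N C∈ with ∈-++⁻ (odd (suc j) m) C∈
  ... | inj₁ C∈odd = innerLines⊆ (≤-trans (s≤s (m≤m+n j m)) j+m<H) (≤-trans (s≤s (m≤n+m m j)) j+m<H) (odd⊆innerLines j m C∈odd)
    where
    j+m<H : j + m < H
    j+m<H = ≤-pred (subst (λ n → suc n ≤ N) (+-suc j m) j+m<N)
  ... | inj₂ C∈row = row⊆lines (suc j) m (≤-trans (+-monoʳ-≤ (suc j) (n≤1+n m)) j+m<N) C∈row

  small : ∀ j j′ {m n} → m ≤ N → n ≤ N → 22 + length (row j m ++ row j′ n) ≤ maxSpace
  small j j′ {m} {n} m≤N n≤N = begin
    22 + length (row j m ++ row j′ n)   ≡⟨ cong (22 +_) (trans (length-++ (row j m)) (cong₂ _+_ (row-length j m) (row-length j′ n))) ⟩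
    22 + (m * 2 + n * 2)                ≤⟨ +-monoʳ-≤ 22 (+-mono-≤ (*-monoˡ-≤ 2 m≤N) (*-monoˡ-≤ 2 n≤N)) ⟩
    22 + (N * 2 + N * 2)                ≡⟨ id₁ N ⟩
    4 * N + 22                          ∎
    where
    open ≤-Reasoning
    id₁ : ∀ n → 22 + (n * 2 + n * 2) ≡ 4 * n + 22
    id₁ = solve-∀

  union⊆ : ∀ {S T U : ClauseSet V} → S ⊆ U → T ⊆ U → S ++ T ⊆ U
  union⊆ {S} S⊆U T⊆U C∈ with ∈-++⁻ S C∈
  ... | inj₁ C∈S = S⊆U C∈S
  ... | inj₂ C∈T = T⊆U C∈T

  firstRow : ∀ m → m ≤ N → Star Move [] (row 0 m)
  firstRow zero    _   = ε
  firstRow (suc m) m<N = firstRow m (<⇒≤ m<N) ◅◅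
    extend (source (there (here refl))) (λ C∈ → C∈) (down there holds) ◅
    extend (source (here refl)) (λ C∈ → C∈) holds ◅ ε
    where
    holds : Holds (row 0 (suc m))
    holds = bounded (≤-trans (≤-trans (≤-reflexive (cong length (sym (++-identityʳ (row 0 (suc m)))))) (m≤n+m _ 22))
      (small 0 0 {suc m} {0} m<N z≤n)) (row⊆lines 0 (suc m) m<N)
    source : ∀ {C S} → C ∈ odd 0 m → Derivable pyramid S C
    source C∈ = axiom (∈-++⁺ˡ (source⊆ m<N C∈))

  -- A row of `n` vertices yields at most n - 1 on the next level, where (suc j , i) needs (j , i)
  -- and (j , suc i). After each vertex all but its two clauses are erased from the local
  -- derivation.
  nextRow : ∀ j n m → j + n ≤ N → m < n → Star Move (row j n) (row (suc j) m ++ row j n)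
  nextRow j n zero    j+n≤N _     = ε
  nextRow j n (suc m) j+n≤N 1+m<n = nextRow j n m j+n≤N (<⇒≤ 1+m<n) ◅◅
    rename-derivation (local-injective j<H m<H) (λ {C} → axioms⊆ j<H m<H {C}) bounds {S = row (suc j) m ++ row j n}
      premises⊆ innerDerivation holds ◅◅
    weaken keep (down keep holds) ◅ ε
    where
    j+m<H : suc (j + m) ≤ H
    j+m<H = ≤-pred (≤-trans (≤-reflexive (cong suc (sym (+-suc j m)))) (≤-trans (≤-reflexive (sym (+-suc j (suc m)))) (≤-trans (+-monoʳ-≤ j 1+m<n) j+n≤N)))
    j<H : j < H
    j<H = ≤-trans (s≤s (m≤m+n j m)) j+m<H
    m<H : m < H
    m<H = ≤-trans (s≤s (m≤n+m m j)) j+m<H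
    premises⊆ : map (rename (local j m)) premises ⊆ row (suc j) m ++ row j n
    premises⊆ C∈ = ∈-++⁺ʳ (row (suc j) m) (union⊆ (odd⊆row j (<⇒≤ 1+m<n)) (odd⊆row j 1+m<n) C∈)
    keep : row (suc j) (suc m) ++ row j n ⊆ map (rename (local j m)) innerLines ++ row (suc j) m ++ row j n
    keep = union⊆ {odd (suc j) m} (∈-++⁺ˡ ∘ odd⊆innerLines j m) (∈-++⁺ʳ (map (rename (local j m)) innerLines))
    holds : Holds (map (rename (local j m)) innerLines ++ row (suc j) m ++ row j n)
    holds = bounded (small (suc j) j (≤-trans (<⇒≤ m<H) (n≤1+n H)) (≤-trans (m≤n+m n j) j+n≤N))
      (union⊆ (innerLines⊆ j<H m<H) (union⊆ (row⊆lines (suc j) m (s≤s (<⇒≤ j+m<H))) (row⊆lines j n j+n≤N)))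

  -- Row `j` of the triangle has H + 1 - j vertices, which is `suc k`; at level `H` only the sink is
  -- left.
  laterRows : ∀ k j → j + k ≡ H → Star Move (row 0 N) (row j (suc k))
  laterRows k zero    refl   = ε
  laterRows k (suc j) 1+j+k≡H = laterRows (suc k) j j+1+k≡H ◅◅ nextRow j (2 + k) (suc k) (≤-reflexive j+2+k≡N) ≤-refl ◅◅
    weaken ∈-++⁺ˡ (bounded row≤ (row⊆lines (suc j) (suc k) (≤-reflexive (trans (cong suc (+-suc j k)) (cong suc 1+j+k≡H))))) ◅ ε
    where
    j+1+k≡H : j + suc k ≡ H
    j+1+k≡H = trans (+-suc j k) 1+j+k≡H
    j+2+k≡N : j + (2 + k) ≡ N
    j+2+k≡N = trans (+-suc j (suc k)) (cong suc j+1+k≡H)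
    row≤ : length (row (suc j) (suc k)) ≤ maxSpace
    row≤ = ≤-trans (≤-trans (≤-reflexive (cong length (sym (++-identityʳ (row (suc j) (suc k)))))) (m≤n+m _ 22))
      (small (suc j) 0 {suc k} {0} (subst (suc k ≤_) j+2+k≡N (≤-trans (n≤1+n (suc k)) (m≤n+m (2 + k) j))) z≤n)

  sinkRefuted : Star Move (row H 1) [ 𝟘 ]
  sinkRefuted = rename-derivation (var-injective H 0) (λ {C} → sinkAxioms⊆ {C}) bounds {S = row H 1} (λ C∈ → C∈) sinkDerivation holds ◅◅
    weaken last (down last holds) ◅ ε
    where
    sinkAxioms⊆ : map (rename (var H 0)) evenClauses ⊆ pyramid
    sinkAxioms⊆ C∈ = ∈-++⁺ʳ sources (∈-++⁺ʳ (concatMap inner grid) C∈)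
    last : [ 𝟘 ] ⊆ map (rename (var H 0)) sinkLines ++ row H 1
    last (here p) = here p
    inners⊆ : map (rename (var H 0)) sinkLines ⊆ lines
    inners⊆ C∈ = ∈-++⁺ʳ sources (∈-++⁺ʳ (concatMap inners grid) C∈)
    holds : Holds (map (rename (var H 0)) sinkLines ++ row H 1)
    -- Seven clauses: the five `sinkLines` and the two of `row H 1`.
    holds = bounded (≤-trans (m≤n+m 7 15) (m≤n+m 22 (4 * N)))
      (union⊆ {map (rename (var H 0)) sinkLines} inners⊆
        (row⊆lines H 1 (≤-reflexive (trans (+-suc H 0) (cong suc (+-identityʳ H))))))

  refutation : BoundedRefutation
  refutation = moves⇒refutation (bounded z≤n λ ())
    (firstRow N ≤-refl ◅◅ laterRows 0 H (+-identityʳ H) ◅◅ sinkRefuted)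

  grid-length : length grid ≡ H * H
  grid-length = trans (cartesianProduct-length (upTo H) (upTo H)) (cong₂ _*_ (length-upTo H) (length-upTo H))

  sources-length : length sources ≡ N * 2
  sources-length = trans (concatMap-length (odd 0) 2 (upTo N) (λ _ → refl)) (cong (_* 2) (length-upTo N))

  lines-length : length lines ≡ N * 2 + (H * H * 22 + 5)
  lines-length = begin
    length lines
      ≡⟨ length-++ sources ⟩
    length sources + length (concatMap inners grid ++ map (rename (var H 0)) sinkLines)
      ≡⟨ cong (length sources +_) (length-++ (concatMap inners grid)) ⟩
    length sources + (length (concatMap inners grid) + 5)
      ≡⟨ cong₂ (λ m n → m + (n + 5)) sources-length (trans (concatMap-length inners 22 grid (λ _ → refl)) (cong (_* 22) (grid-length))) ⟩
    N * 2 + (H * H * 22 + 5) ∎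
    where
    open ≡-Reasoning

  Narrow : Clause V → Set
  Narrow C = ∣ C ∣ᶜ ≤ 4

  narrow-rename : ∀ {m} (σ : Fin m → Fin V) Cs {_ : True (All.all? (λ C → ∣ C ∣ᶜ ≤? 4) Cs)} → All Narrow (map (rename σ) Cs)
  narrow-rename σ Cs {narrow} = All.map⁺ (All.map (λ {C} → ≤-trans (width-rename σ C)) (toWitness narrow))

  narrow-concatMap : ∀ {A : Set} (f : A → CNF V) → (∀ x → All Narrow (f x)) → ∀ xs → All Narrow (concatMap f xs)
  narrow-concatMap f narrow xs = All.concat⁺ (All.map⁺ (All.universal narrow xs))

  sources-narrow : All Narrow sources
  sources-narrow = narrow-concatMap (odd 0) (λ i → narrow-rename (var 0 i) oddClauses) (upTo N)

  lines-narrow : All Narrow lines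
  lines-narrow = All.++⁺ sources-narrow (All.++⁺
    (narrow-concatMap inners (λ (j , i) → narrow-rename (local j i) innerLines) grid)
    (narrow-rename (var H 0) sinkLines))

  pyramid-narrow : All Narrow pyramid
  pyramid-narrow = All.++⁺ sources-narrow (All.++⁺
    (narrow-concatMap inner (λ (j , i) → narrow-rename (local j i) innerClauses) grid)
    (narrow-rename (var H 0) evenClauses))

  minimalLength : ∀ {L} → L[ pyramid ⊢0]≡ L → L ≤ N * 2 + (H * H * 22 + 5)
  minimalLength (_ , least) = ≤-trans (least (proj₁ refutation))
    (≤-trans (length≤⇐ (proj₁ refutation) (All.map proj₂ (proj₂ refutation))) (≤-reflexive lines-length))

  minimalWidth : ∀ {W} → W[ pyramid ⊢0]≡ W → W ≤ 4
  minimalWidth (_ , least) = ≤-trans (least (proj₁ refutation))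
    (width≤⇐ (proj₁ refutation) (All.map (λ (_ , S⊆) → All.tabulate (All.lookup lines-narrow ∘ S⊆)) (proj₂ refutation)))

  minimalSpace : ∀ {s} → Sp[ pyramid ⊢0]≡ s → s ≤ 4 * N + 22
  minimalSpace (_ , least) = ≤-trans (least (proj₁ refutation))
    (space≤⇐ (proj₁ refutation) (All.map proj₁ (proj₂ refutation)))

  pyramid-length : length pyramid ≡ N * 2 + (H * H * 8 + 2)
  pyramid-length = begin
    length pyramid
      ≡⟨ length-++ sources ⟩
    length sources + length (concatMap inner grid ++ map (rename (var H 0)) evenClauses)
      ≡⟨ cong (length sources +_) (length-++ (concatMap inner grid)) ⟩
    length sources + (length (concatMap inner grid) + 2)
      ≡⟨ cong₂ (λ m n → m + (n + 2)) sources-length (trans (concatMap-length inner 8 grid (λ _ → refl)) (cong (_* 8) grid-length)) ⟩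
    N * 2 + (H * H * 8 + 2) ∎
    where open ≡-Reasoning

-- Size of the formulas

Unique-map : ∀ {A B : Set} (f : A → B) {xs} → (∀ {x y} → x ∈ xs → y ∈ xs → f x ≡ f y → x ≡ y) →
  Unique xs → Unique (map f xs)
Unique-map f inj []             = []
Unique-map f inj (x∉xs ∷ !xs) =
  All.map⁺ (All.tabulate λ y∈ fx≡fy → All.lookup x∉xs y∈ (inj (here refl) (there y∈) fx≡fy))
  ∷ Unique-map f (λ x∈ y∈ → inj (there x∈) (there y∈)) !xs

sum-map≤ : ∀ {A : Set} (f : A → ℕ) k {xs} → All (λ x → f x ≤ k) xs → foldr _+_ 0 (map f xs) ≤ k * length xs
sum-map≤ f k []       = z≤n
sum-map≤ f k {x ∷ xs} (fx≤k ∷ ≤k) = ≤-trans (+-mono-≤ fx≤k (sum-map≤ f k ≤k)) (≤-reflexive (sym (*-suc k (length xs))))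

filter-positive≤sum : ∀ {A : Set} (f : A → ℕ) xs → length (filter (λ x → 1 ≤? f x) xs) ≤ foldr _+_ 0 (map f xs)
filter-positive≤sum f []       = z≤n
filter-positive≤sum f (x ∷ xs) with f x
... | zero  = filter-positive≤sum f xs
... | suc k = s≤s (≤-trans (filter-positive≤sum f xs) (m≤n+m _ k))

literal⇒width≥1 : ∀ {v} (C : Clause v) x {b} → (x , b) ∈ᶜ C → 1 ≤ ∣ C ∣ᶜ
literal⇒width≥1 (just _ ∷ C)  x       _  = s≤s z≤n
literal⇒width≥1 (nothing ∷ C) (suc x) Cx = literal⇒width≥1 C x Cx

size≤ : ∀ {v} k (F : CNF v) → All (λ C → ∣ C ∣ᶜ ≤ k) F → size F ≤ k * length F
size≤ k F narrow = ≤-trans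
  (sum-map≤ ∣_∣ᶜ k (All.tabulate (All.lookup narrow ∘ ∈-deduplicate⁻ _≟_ F)))
  (*-monoʳ-≤ k (length-deduplicate _≟_ F))

module Size (H : ℕ) where

  open Pyramid H

  -- One axiom per grid vertex is enough for the lower bound on size. Its only positive literal in
  -- slot `2F` reveals the vertex, so these axioms remain distinct under deduplication.
  marked : Clause 12
  marked = clause (neg (u 0F) ∷ pos (u 1F) ∷ pos (w 0F) ∷ pos (w 2F) ∷ [])

  marked-slot : ∀ y → proj₂ (remQuot {3} 4 y) ≡ 2F → lookup marked y ≡ just true → y ≡ w 2F
  marked-slot = toWitness {a? = Fin.all? λ y → proj₂ (remQuot {3} 4 y) Fin.≟ 2F →-dec
    (Maybe.≡-dec Bool._≟_ (lookup marked y) (just true) →-dec y Fin.≟ w 2F)} _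

  mark : ℕ × ℕ → Clause V
  mark (j , i) = rename (local j i) marked

  mark-literal : ∀ {j i} → j < H → i < H → (local j i (w 2F) , true) ∈ᶜ mark (j , i)
  mark-literal j<H i<H = lookup-rename (local-injective j<H i<H) marked (w 2F)

  mark-injective : ∀ {j i j′ i′} → j < H → i < H → j′ < H → i′ < H → mark (j , i) ≡ mark (j′ , i′) → (j , i) ≡ (j′ , i′)
  mark-injective {j} {i} {j′} {i′} j<H i<H j′<H i′<H eq
    with lookup-rename⁻ (local j′ i′) marked (trans (cong (λ C → lookup C (local j i (w 2F))) (sym eq)) (mark-literal j<H i<H))
  ... | y , var≡ , y∈ with marked-slot y (trans (sym (slot-local j′ i′ y)) (trans (cong slot (sym var≡)) (slot-local j i (w 2F)))) y∈
  -- The corner holding the literal is (suc j , i), hence `pred`.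
  ...   | refl = cong (λ (j , i) → pred j , i)
    (trans (sym (vertexOf-local j<H i<H (w 2F))) (trans (cong vertexOf var≡) (vertexOf-local j′<H i′<H (w 2F))))

  size-lower : H * H ≤ size pyramid
  size-lower = begin
    H * H                                                          ≡⟨ UpperBound.grid-length H ⟨
    length grid                                                    ≡⟨ length-map mark grid ⟨
    length (map mark grid)                                         ≤⟨ Unique-⊆⇒length≤ _≟_ unique marks⊆ ⟩
    length (filter (λ C → 1 ≤? ∣ C ∣ᶜ) (elements pyramid))         ≤⟨ filter-positive≤sum ∣_∣ᶜ (elements pyramid) ⟩
    size pyramid                                                   ∎
    where
    open ≤-Reasoning
    in-range : ∀ {j i} → (j , i) ∈ grid → j < H × i < H
    in-range p∈ = let j∈ , i∈ = ∈-cartesianProduct⁻ (upTo H) (upTo H) p∈ in ∈-upTo⁻ j∈ , ∈-upTo⁻ i∈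
    unique : Unique (map mark grid)
    unique = Unique-map mark
      (λ p∈ q∈ → let j< , i< = in-range p∈ ; j′< , i′< = in-range q∈ in mark-injective j< i< j′< i′<)
      (Unique.cartesianProduct⁺ (Unique.upTo⁺ H) (Unique.upTo⁺ H))
    marks⊆ : map mark grid ⊆ filter (λ C → 1 ≤? ∣ C ∣ᶜ) (elements pyramid)
    marks⊆ C∈ with ∈-map⁻ mark C∈
    ... | (j , i) , p∈ , refl with in-range p∈
    ...   | j<H , i<H = ∈-filter⁺ (λ C → 1 ≤? ∣ C ∣ᶜ)
      (∈-deduplicate⁺ _≟_ (UpperBound.axioms⊆ H j<H i<H (here refl)))
      (literal⇒width≥1 (mark (j , i)) _ (mark-literal j<H i<H))

  size-upper : size pyramid ≤ 4 * (N * 2 + (H * H * 8 + 2))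
  size-upper = ≤-trans (size≤ 4 pyramid (UpperBound.pyramid-narrow H))
    (≤-reflexive (cong (4 *_) (UpperBound.pyramid-length H)))

-- The choice of heights and the asymptotic bounds

root : ∀ n → ∃[ h ] h * h ≤ n × n < suc h * suc h
root zero    = 0 , z≤n , s≤s z≤n
root (suc n) with root n
... | h , h²≤n , n<  with suc n <? suc h * suc h
...   | yes 1+n< = h , m≤n⇒m≤1+n h²≤n , 1+n<
...   | no  1+n≮ = suc h , ≮⇒≥ 1+n≮ , ≤-<-trans n< (*-mono-< (n<1+n (suc h)) (n<1+n (suc h)))

height : ℕ → ℕ
height n = proj₁ (root n)

height²≤ : ∀ n → height n * height n ≤ n
height²≤ n = proj₁ (proj₂ (root n))

<height² : ∀ n → n < suc (height n) * suc (height n)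
<height² n = proj₂ (proj₂ (root n))

height≥1 : ∀ {n} → 1 ≤ n → 1 ≤ height n
height≥1 {n} 1≤n with height n | <height² n
... | zero  | s≤s n≤0 = contradiction (≤-trans 1≤n n≤0) λ ()
... | suc h | _       = s≤s z≤n

height≤ : ∀ n → height n ≤ n
height≤ n = ≤-trans (h≤h² (height n)) (height²≤ n)
  where
  h≤h² : ∀ h → h ≤ h * h
  h≤h² zero    = z≤n
  h≤h² (suc h) = m≤m*n (suc h) (suc h)

-- The 4 comes from `suc H ≤ n + n`, a consequence of `H ≤ n` and `1 ≤ n`.
linear-in-n : ∀ a b {n} → 1 ≤ n → (let H = height n) → suc H * 2 + (H * H * a + b) ≤ (4 + a + b) * n
linear-in-n a b {n} 1≤n = begin
  suc H * 2 + (H * H * a + b)           ≤⟨ +-mono-≤ (*-monoˡ-≤ 2 (+-mono-≤ 1≤n (height≤ n))) (+-mono-≤ (*-monoˡ-≤ a (height²≤ n)) (m≤m*n b n {{>-nonZero 1≤n}})) ⟩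
  (n + n) * 2 + (n * a + b * n)         ≡⟨ id₁ a b n ⟩
  (4 + a + b) * n                       ∎
  where
  H = height n
  open ≤-Reasoning
  id₁ : ∀ a b n → (n + n) * 2 + (n * a + b * n) ≡ (4 + a + b) * n
  id₁ = solve-∀

formula : ∀ n → CNF (Pyramid.V (height n))
formula n = Pyramid.pyramid (height n)

abstract

  minimal : ∀ H → let F = Pyramid.pyramid H in ∃[ L ] ∃[ W ] ∃[ s ] L[ F ⊢0]≡ L × W[ F ⊢0]≡ W × Sp[ F ⊢0]≡ s
  minimal H =
    let ρ = proj₁ (UpperBound.refutation H)
        L , isL = minimumLength ρ ; W , isW = minimumWidth ρ ; s , isS = minimumSpace ρ
    in L , W , s , isL , isW , isS

minimalSpace> : ∀ H {s} → Sp[ Pyramid.pyramid H ⊢0]≡ s → H < 18 * s + 3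
minimalSpace> H ((π , π≡) , _) = LowerBound.space-bound H π (≤-reflexive π≡)

-- Space 0 would give h < 3 and so n < 9, which the threshold 9 excludes. For s ≥ 1 the constant 3
-- is absorbed as 3 s, giving 18 + 3 = 21.
square-bound : ∀ s {h n} → 9 ≤ n → n < suc h * suc h → h < 18 * s + 3 → n ≤ (21 * s) ^ 2
square-bound zero    n≥9 n< h<3 = contradiction (≤-trans n< (*-mono-≤ h<3 h<3)) (<⇒≱ (s≤s n≥9))
square-bound (suc t) {h} {n} _ n< h< = begin
  n                                      ≤⟨ <⇒≤ n< ⟩
  suc h * suc h                          ≤⟨ *-mono-≤ h≤ h≤ ⟩
  (21 * suc t) * (21 * suc t)            ≡⟨ cong ((21 * suc t) *_) (*-identityʳ (21 * suc t)) ⟨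
  (21 * suc t) ^ 2                       ∎
  where
  open ≤-Reasoning
  id₁ : ∀ t → 18 * suc t + 3 * suc t ≡ 21 * suc t
  id₁ = solve-∀
  h≤ : suc h ≤ 21 * suc t
  h≤ = begin
    suc h                     ≤⟨ h< ⟩
    18 * suc t + 3            ≤⟨ +-monoʳ-≤ (18 * suc t) (*-monoʳ-≤ 3 (s≤s z≤n)) ⟩
    18 * suc t + 3 * suc t    ≡⟨ id₁ t ⟩
    21 * suc t                ∎

module Family where

  open ≤-Reasoning

  L W Sp : ℕ → ℕ
  L n  = proj₁ (minimal (height n))
  W n  = proj₁ (proj₂ (minimal (height n)))
  Sp n = proj₁ (proj₂ (proj₂ (minimal (height n))))

  isL : ∀ n → L[ formula n ⊢0]≡ L n
  isL n = proj₁ (proj₂ (proj₂ (proj₂ (minimal (height n)))))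

  isW : ∀ n → W[ formula n ⊢0]≡ W n
  isW n = proj₁ (proj₂ (proj₂ (proj₂ (proj₂ (minimal (height n))))))

  isS : ∀ n → Sp[ formula n ⊢0]≡ Sp n
  isS n = proj₂ (proj₂ (proj₂ (proj₂ (proj₂ (minimal (height n))))))

  size-O : ∀ n → n ≥ 1 → size (formula n) ≤ 56 * n
  size-O n n≥1 = begin
    size (formula n)                       ≤⟨ Size.size-upper (height n) ⟩
    -- 14 is 4 + 8 + 2, with eight axioms per grid vertex and two for the sink.
    4 * (suc (height n) * 2 + (height n * height n * 8 + 2)) ≤⟨ *-monoʳ-≤ 4 (linear-in-n 8 2 n≥1) ⟩
    4 * (14 * n)                           ≡⟨ *-assoc 4 14 n ⟨
    56 * n                                 ∎

  size-Ω : ∀ n → n ≥ 1 → n ≤ 4 * size (formula n)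
  size-Ω n n≥1 = begin
    n                                      ≤⟨ <⇒≤ (<height² n) ⟩
    suc H * suc H                          ≤⟨ *-mono-≤ 1+H≤2H 1+H≤2H ⟩
    (H + H) * (H + H)                      ≡⟨ id₁ H ⟩
    4 * (H * H)                            ≤⟨ *-monoʳ-≤ 4 (Size.size-lower H) ⟩
    4 * size (formula n)                   ∎
    where
    H = height n
    1+H≤2H : suc H ≤ H + H
    1+H≤2H = +-monoˡ-≤ H (height≥1 n≥1)
    id₁ : ∀ h → (h + h) * (h + h) ≡ 4 * (h * h)
    id₁ = solve-∀

  L-O : ∀ n → n ≥ 1 → L n ≤ 31 * n
  -- 31 is 4 + 22 + 5, from the numbers of `innerLines` and `sinkLines`.
  L-O n n≥1 = ≤-trans (UpperBound.minimalLength (height n) (isL n)) (linear-in-n 22 5 n≥1)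

  s-O : ∀ n → n ≥ 1 → Sp n ^ 2 ≤ 30 ^ 2 * n
  s-O n n≥1 = begin
    Sp n ^ 2                                ≤⟨ ^-monoˡ-≤ 2 (≤-trans (UpperBound.minimalSpace H (isS n)) ≤30H) ⟩
    (30 * H) ^ 2                           ≡⟨ id₂ 30 H ⟩
    30 ^ 2 * (H * H)                       ≤⟨ *-monoʳ-≤ (30 ^ 2) (height²≤ n) ⟩
    30 ^ 2 * n                             ∎
    where
    H = height n
    id₁ : ∀ h → 4 * h + 26 * h ≡ 30 * h
    id₁ = solve-∀
    id₂ : ∀ a h → (a * h) * (a * h * 1) ≡ a * (a * 1) * (h * h)
    id₂ = solve-∀
    ≤30H : 4 * suc H + 22 ≤ 30 * H
    ≤30H = begin
      4 * suc H + 22                       ≡⟨ id₃ H ⟩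
      4 * H + 26 * 1                       ≤⟨ +-monoʳ-≤ (4 * H) (*-monoʳ-≤ 26 (height≥1 n≥1)) ⟩
      4 * H + 26 * H                       ≡⟨ id₁ H ⟩
      30 * H                               ∎
      where
      id₃ : ∀ h → 4 * suc h + 22 ≡ 4 * h + 26 * 1
      id₃ = solve-∀

  s-Ω : ∀ n → n ≥ 9 → n ≤ (21 * Sp n) ^ 2
  s-Ω n n≥9 = square-bound (Sp n) n≥9 (<height² n) (minimalSpace> (height n) (isS n))

corollary1p2 : ∀ (k : ℕ) → k ≥ 4 →
    Σ[ v ∈ (ℕ → ℕ) ] Σ[ F ∈ (∀ n → CNF (v n)) ]
    (∀ n → n ≥ 1 → IsCNF[ k ] (F n) × Unsatisfiable (F n)) ×
    (λ n → size (F n)) ∈Θ (λ n → n) ×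
    (Σ[ L ∈ (ℕ → ℕ) ]
    (∀ n → n ≥ 1 → L[ F n ⊢0]≡ L n) × L ∈O (λ n → n)) ×
    (Σ[ W ∈ (ℕ → ℕ) ]
    (∀ n → n ≥ 1 → W[ F n ⊢0]≡ W n) × W ∈O (λ n → 1)) ×
    (Σ[ Sp ∈ (ℕ → ℕ) ]
    (∀ n → n ≥ 1 → Sp[ F n ⊢0]≡ Sp n) × Sp ∈Θ√ (λ n → n))
corollary1p2 k k≥4 = (λ n → Pyramid.V (height n)) , formula
  , (λ n _ → All.map (λ w≤4 → ≤-trans w≤4 k≥4) (UpperBound.pyramid-narrow (height n))
           , refutation⇒unsatisfiable (proj₁ (UpperBound.refutation (height n))))
  , ((56 , 1 , size-O) , (4 , 1 , size-Ω))
  , (L , (λ n _ → isL n) , 31 , 1 , L-O)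
  , (W , (λ n _ → isW n) , 4 , 0 , λ n _ → UpperBound.minimalWidth (height n) (isW n))
  , (Sp , (λ n _ → isS n) , (30 , 1 , s-O) , (21 , 9 , s-Ω))
  where open Family
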